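{- For naturally ordered finite distributive lattices $\mathcal{L}_\sqsubset$ and $\mathcal{K}_\prec$, let $\mathrm{Con}^+(\mathcal{L}_\sqsubset)$ denote the set of positive congruences of $\mathcal{L}_\sqsubset$, and let $$\mathrm{Con}^+(\mathcal{L}_\sqsubset,\mathcal{K}_\prec)=\{\Phi\in\mathrm{Con}^+(\mathcal{L}_\sqsubset) : \mathcal{L}_\sqsubset/\Phi\cong\mathcal{K}_\prec\}.$$ For every naturally ordered finite distributive lattice $\mathcal{L}_\sqsubset$, every $\Phi\in\mathrm{Con}^+(\mathcal{L}_\sqsubset)$ and every integer $k\ge 2$ there is a naturally ordered finite distributive lattice $\mathcal{N}_\triangleleft$ such that for every $k$-coloring of $\mathrm{Con}^+(\mathcal{N}_\triangleleft,\mathcal{L}_\sqsubset/\Phi)$ there is a congruence $\Psi\in\mathrm{Con}^+(\mathcal{N}_\triangleleft,\mathcal{L}_\sqsubset)$ such that the set of all congruences from $\mathrm{Con}^+(\mathcal{N}_\triangleleft,\mathcal{L}_\sqsubset/\Phi)$ which contain $\Psi$ is monochromatic.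
   Context: Lattices have bottom $0$ and top $1$ in the signature; $\le$ (strict part $<$) denotes the lattice order. $J(\mathcal{L})$ is the set of join-irreducible elements of $\mathcal{L}$ ($0$ is not join-irreducible); the empty join is $0$. Natural order: let $\sqsubset^0$ be a (strict) linear order on $J(\mathcal{L})$ extending $<$ on $J(\mathcal{L})$, and write $J(\mathcal{L})=\{j_1\sqsubset^0\dots\sqsubset^0 j_n\}$. For $x\in L$ let $\delta_i(x)=1$ if $j_i\le x$ and $\delta_i(x)=0$ otherwise. The antilexicographic order $\sqsubset$ on $L$ with respect to $\sqsubset^0$ is: $x\sqsubset y$ iff there is $s$ with $\delta_s(x)<\delta_s(y)$ and $\delta_t(x)=\delta_t(y)$ for all $t>s$. A linear order on $L$ is natural if it arises this way from some such $\sqsubset^0$. A naturally ordered finite distributive lattice $\mathcal{L}_\sqsubset$ is a finite distributive lattice $\mathcal{L}$ together with a natural linear order $\sqsubset$; $\sqsubseteq$ is the reflexive version of $\sqsubset$. Isomorphisms ($\cong$) of such structures are lattice isomorphisms that preserve the linear orders. For a congruence $\Phi$ of $\mathcal{L}$ let $N(\Phi)=\{x\in L : \exists y\in L\ (y<x \text{ and } (x,y)\in\Phi)\}$, and for $x\in L$, $S\subseteq L$ let $x-S=\bigvee\{j\in J(\mathcal{L}) : j\le x,\ j\notin S\}$. $\Phi$ is a positive congruence of $\mathcal{L}_\sqsubset$ if for every pair $A,B$ of distinct $\Phi$-classes, either $a-N(\Phi)\sqsubseteq b-N(\Phi)$ for all $a\in A,b\in B$, or $a-N(\Phi)\sqsupseteq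 b-N(\Phi)$ for all $a\in A,b\in B$. For a positive congruence $\Phi$, $\mathcal{L}_\sqsubset/\Phi$ denotes the quotient lattice $\mathcal{L}/\Phi$ with the natural linear order $\preceq$ given by $A\preceq B$ iff $a-N(\Phi)\sqsubseteq b-N(\Phi)$ for all $a\in A$, $b\in B$. A $k$-coloring of a set is a decomposition of it into $k$ pairwise disjoint (possibly empty) subsets; a subset is monochromatic if it is contained in one of these. A congruence is regarded as a set of pairs, so "contains" means set inclusion. -}

module Defs where

open import Level using (0ℓ) renaming (suc to lsuc)
open import Algebra.Definitions using (Congruent₂)
open import Algebra.Lattice.Bundles using (DistributiveLattice)
open import Algebra.Lattice.Morphism.Structures using (IsLatticeIsomorphism)
import Algebra.Lattice.Properties.Lattice as LatticeProperties
open import Data.Bool.Base using (if_then_else_)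
open import Data.Fin.Base using (Fin)
open import Data.List.Base using (List; foldr; filter)
open import Data.List.Relation.Unary.All as All using ()
open import Data.List.Relation.Unary.Any as Any using ()
open import Data.List.Relation.Unary.Enumerates.Setoid using (IsEnumeration)
open import Data.Nat.Base as ℕ using (ℕ)
open import Data.Product.Base using (Σ; Σ-syntax; ∃; ∃-syntax; _×_; _,_; proj₁; proj₂)
open import Data.Sum.Base as Sum using (_⊎_)
open import Function.Base using (_on_)
open import Function.Bundles using (Func; _⇔_)
open import Relation.Binary.Bundles using (Setoid; Poset)
open import Relation.Binary.Core using (Rel; _⇒_)
open import Relation.Binary.Definitions using (Maximum; Minimum; Decidable; _Respects_)
import Relation.Binary.Construct.NonStrictToStrict as ToStrict
import Relation.Binary.Construct.StrictToNonStrict as ToNonStrict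
open import Relation.Binary.Morphism.Structures using (IsOrderIsomorphism)
open import Relation.Binary.PropositionalEquality as ≡ using (_≡_)
open import Relation.Binary.Structures using (IsDecEquivalence; IsStrictTotalOrder)
open import Relation.Nullary using (¬_; Dec; does)
open import Relation.Nullary.Decidable using (map′; ¬?; _×-dec_; _⊎-dec_; _→-dec_)
import Relation.Unary as U
open U using (Pred)

-- Elements are compared by a setoid equality _≈_, so that a quotient lattice
-- is the same carrier with a coarser equality.  Finiteness is a decidable
-- equality together with a list (repetitions allowed) of all elements.
record FiniteDistributiveLattice : Set₁ where
  field
    distributiveLattice : DistributiveLattice 0ℓ 0ℓ

  open DistributiveLattice distributiveLattice public
  open Poset (LatticeProperties.poset lattice) public
    using (_≤_)
    renaming (trans to ≤-trans; reflexive to ≤-reflexive)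
  open ToStrict _≈_ _≤_ public using (_<_)

  field
    0# 1#    : Carrier
    minimum  : Minimum _≤_ 0#
    maximum  : Maximum _≤_ 1#
    _≟_      : Decidable _≈_
    elements : List Carrier
    complete : IsEnumeration setoid elements

  JoinIrreducible : Pred Carrier 0ℓ
  JoinIrreducible j = ¬ (j ≈ 0#) × (∀ x y → x ∨ y ≈ j → x ≈ j ⊎ y ≈ j)

  J : Set
  J = Σ Carrier JoinIrreducible

  _≤?_ : Decidable _≤_
  x ≤? y = x ≟ (x ∧ y)

  _<?_ : Decidable _<_
  x <? y = (x ≤? y) ×-dec ¬? (x ≟ y)

  all? : ∀ {P : Pred Carrier 0ℓ} → P Respects _≈_ → U.Decidable P → Dec (∀ x → P x)
  all? resp P? = map′
    (λ ps x → All.lookupWith (λ p x≈y → resp (sym x≈y) p) ps (complete x))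
    (λ p → All.universal p elements)
    (All.all? P? elements)

  any? : ∀ {P : Pred Carrier 0ℓ} → P Respects _≈_ → U.Decidable P → Dec (∃ P)
  any? resp P? = map′
    Any.satisfied
    (λ (x , p) → Any.map (λ x≈y → resp x≈y p) (complete x))
    (Any.any? P? elements)

  joinIrreducible? : U.Decidable JoinIrreducible
  joinIrreducible? j = ¬? (j ≟ 0#) ×-dec
    all? (λ x≈x′ p y x′∨y≈j →
            Sum.map₁ (trans (sym x≈x′)) (p y (trans (∨-congʳ x≈x′) x′∨y≈j)))
         (λ x → all? (λ y≈y′ p x∨y′≈j →
                        Sum.map₂ (trans (sym y≈y′)) (p (trans (∨-congˡ y≈y′) x∨y′≈j)))
                     (λ y → ((x ∨ y) ≟ j) →-dec ((x ≟ j) ⊎-dec (y ≟ j))))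

  ⋁ : List Carrier → Carrier
  ⋁ = foldr _∨_ 0#

  -- x − S = ⋁ { j ∈ J : j ≤ x , j ∉ S }
  difference : Carrier → {S : Pred Carrier 0ℓ} → U.Decidable S → Carrier
  difference x S? =
    ⋁ (filter (λ j → joinIrreducible? j ×-dec ((j ≤? x) ×-dec ¬? (S? j))) elements)

  δ : J → Carrier → ℕ
  δ (j , _) x = if does (j ≤? x) then 1 else 0

  -- The positions 1, …, n are represented by the join-irreducibles themselves:
  -- s < t as positions is s ⊏⁰ t.
  Antilex : Rel J 0ℓ → Rel Carrier 0ℓ
  Antilex _⊏⁰_ x y =
    ∃[ s ] (δ s x ℕ.< δ s y × (∀ t → s ⊏⁰ t → δ t x ≡ δ t y))

  record IsLinearExtension (_⊏⁰_ : Rel J 0ℓ) : Set where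
    field
      isStrictTotalOrder : IsStrictTotalOrder (_≈_ on proj₁) _⊏⁰_
      extends            : (_<_ on proj₁) ⇒ _⊏⁰_

  IsNatural : Rel Carrier 0ℓ → Set₁
  IsNatural _⊏_ = Σ[ _⊏⁰_ ∈ Rel J 0ℓ ]
    (IsLinearExtension _⊏⁰_ × (∀ x y → x ⊏ y ⇔ Antilex _⊏⁰_ x y))

-- No law is imposed on _⊑_ here: this is only the common signature of
-- naturally ordered lattices and their quotients, on which _≅_ is defined.
record OrderedLattice : Set₁ where
  infix 4 _⊑_
  field
    finiteDistributiveLattice : FiniteDistributiveLattice

  open FiniteDistributiveLattice finiteDistributiveLattice public

  field
    _⊑_ : Rel Carrier 0ℓ

record NaturallyOrderedLattice : Set₁ where
  infix 4 _⊏_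
  field
    finiteDistributiveLattice : FiniteDistributiveLattice

  open FiniteDistributiveLattice finiteDistributiveLattice public

  field
    _⊏_       : Rel Carrier 0ℓ
    isNatural : IsNatural _⊏_

  orderedLattice : OrderedLattice
  orderedLattice = record
    { finiteDistributiveLattice = finiteDistributiveLattice
    ; _⊑_                       = ToNonStrict._≤_ _≈_ _⊏_
    }

  open OrderedLattice orderedLattice public using (_⊑_)

infix 4 _≅_

record _≅_ (K₁ K₂ : OrderedLattice) : Set where
  private
    module K₁ = OrderedLattice K₁
    module K₂ = OrderedLattice K₂
  field
    to                   : K₁.Carrier → K₂.Carrier
    isLatticeIsomorphism : IsLatticeIsomorphism K₁.rawLattice K₂.rawLattice to
    0#-homo              : to K₁.0# K₂.≈ K₂.0#
    1#-homo              : to K₁.1# K₂.≈ K₂.1#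
    isOrderIsomorphism   : IsOrderIsomorphism K₁._≈_ K₂._≈_ K₁._⊑_ K₂._⊑_ to

-- Decidability is what being a subset of the finite set L × L amounts to
-- constructively; classically it is no restriction.
record Congruence (L : FiniteDistributiveLattice) : Set₁ where
  open FiniteDistributiveLattice L
  infix 4 _~_
  field
    _~_              : Rel Carrier 0ℓ
    isDecEquivalence : IsDecEquivalence _~_
    ≈⇒~              : _≈_ ⇒ _~_
    ∨-cong~          : Congruent₂ _~_ _∨_
    ∧-cong~          : Congruent₂ _~_ _∧_

  open IsDecEquivalence isDecEquivalence public
    using ()
    renaming (_≟_ to _~?_; isEquivalence to ~-isEquivalence; trans to ~-trans)

  N : Pred Carrier 0ℓ
  N x = ∃[ y ] (y < x × x ~ y)

  N? : U.Decidable N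
  N? x = any?
    (λ { y≈y′ ((y≤x , y≉x) , x~y) →
         (≤-trans (≤-reflexive (sym y≈y′)) y≤x , (λ y′≈x → y≉x (trans y≈y′ y′≈x)))
         , ~-trans x~y (≈⇒~ y≈y′) })
    (λ y → (y <? x) ×-dec (x ~? y))

  _−N : Carrier → Carrier
  x −N = difference x N?

  quotient : FiniteDistributiveLattice
  quotient = record
    { distributiveLattice = record
      { Carrier = Carrier
      ; _≈_     = _~_
      ; _∨_     = _∨_
      ; _∧_     = _∧_
      ; isDistributiveLattice = record
        { isLattice = record
          { isEquivalence = ~-isEquivalence
          ; ∨-comm        = λ x y → ≈⇒~ (∨-comm x y)
          ; ∨-assoc       = λ x y z → ≈⇒~ (∨-assoc x y z)
          ; ∨-cong        = ∨-cong~
          ; ∧-comm        = λ x y → ≈⇒~ (∧-comm x y)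
          ; ∧-assoc       = λ x y z → ≈⇒~ (∧-assoc x y z)
          ; ∧-cong        = ∧-cong~
          ; absorptive    = (λ x y → ≈⇒~ (proj₁ absorptive x y))
                          , (λ x y → ≈⇒~ (proj₂ absorptive x y))
          }
        ; ∨-distrib-∧ = (λ x y z → ≈⇒~ (proj₁ ∨-distrib-∧ x y z))
                      , (λ x y z → ≈⇒~ (proj₂ ∨-distrib-∧ x y z))
        ; ∧-distrib-∨ = (λ x y z → ≈⇒~ (proj₁ ∧-distrib-∨ x y z))
                      , (λ x y z → ≈⇒~ (proj₂ ∧-distrib-∨ x y z))
        }
      }
    ; 0#       = 0#
    ; 1#       = 1#
    ; minimum  = λ x → ≈⇒~ (minimum x)
    ; maximum  = λ x → ≈⇒~ (maximum x)
    ; _≟_      = _~?_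
    ; elements = elements
    ; complete = λ x → Any.map ≈⇒~ (complete x)
    }

-- Φ-classes are given by representatives x and y; a and b run over the classes.
record PositiveCongruence (L : NaturallyOrderedLattice) : Set₁ where
  open NaturallyOrderedLattice L
  field
    congruence : Congruence finiteDistributiveLattice

  open Congruence congruence public

  field
    positive : ∀ x y → ¬ (x ~ y) →
      (∀ {a b} → a ~ x → b ~ y → (a −N) ⊑ (b −N)) ⊎
      (∀ {a b} → a ~ x → b ~ y → (b −N) ⊑ (a −N))

infixl 7 _/_

_/_ : (L : NaturallyOrderedLattice) → PositiveCongruence L → OrderedLattice
L / Φ = record
  { finiteDistributiveLattice = quotient
  ; _⊑_ = λ x y → ∀ {a b} → a ~ x → b ~ y → (a −N) ⊑ (b −N)
  }
  where
  open NaturallyOrderedLattice L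
  open PositiveCongruence Φ

infix 4 _⊆_

_⊆_ : ∀ {L} → PositiveCongruence L → PositiveCongruence L → Set
Ψ ⊆ Θ = PositiveCongruence._~_ Ψ ⇒ PositiveCongruence._~_ Θ

-- Con⁺(L , K).  Two members are equal when they relate the same pairs; the
-- isomorphism witnessing membership is irrelevant.
Con⁺ : NaturallyOrderedLattice → OrderedLattice → Setoid (lsuc 0ℓ) 0ℓ
Con⁺ L K = record
  { Carrier       = Σ[ Φ ∈ PositiveCongruence L ] (L / Φ ≅ K)
  ; _≈_           = λ (Φ , _) (Θ , _) → (Φ ⊆ Θ) × (Θ ⊆ Φ)
  ; isEquivalence = record
    { refl  = (λ p → p) , (λ p → p)
    ; sym   = λ (p , q) → q , p
    ; trans = λ (p , q) (p′ , q′) → (λ r → p′ (p r)) , (λ r → q (q′ r))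
    }
  }

-- The i-th part of the decomposition is the preimage of i.
Coloring : ℕ → Setoid (lsuc 0ℓ) 0ℓ → Set₁
Coloring k S = Func S (≡.setoid (Fin k))

Monochromatic : ∀ {k S} → Coloring k S → Pred (Setoid.Carrier S) 0ℓ → Set₁
Monochromatic {k} χ P = ∃[ i ] (∀ x → P x → Func.to χ x ≡ i)

{-# OPTIONS --safe #-}
module Submission where

-- Every congruence of a naturally ordered lattice is positive, because x −N is
-- the least element of the class of x.  For N take the free bounded
-- distributive lattice on n generators.  A map v from the generators to a
-- naturally ordered lattice K extends to a homomorphism, and if v is a rigid
-- surjection (its values first occur in increasing order) then the kernel
-- belongs to Con⁺(N, K).  Conversely, if Ψ is the kernel given by a rigid
-- surjection w onto L and Θ ∈ Con⁺(N, L/Φ) contains Ψ, then Θ is the kernel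
-- given by ρ ∘ w for a rigid surjection ρ from L onto L/Φ.  So the theorem
-- reduces to the dual Ramsey theorem for rigid surjections, a case of the
-- Graham–Rothschild theorem on parameter words.

-- The order on the join-irreducibles of the free lattice must suit every `K` at once. A
-- homomorphism onto `K` has a lower adjoint, which sends a join-irreducible `p` of `K` to the meet
-- of the generators whose values lie above `p`; the quotient order agrees with that of `K` as soon
-- as this map is monotone on join-irreducibles. The lexicographic order achieves this for rigid
-- surjections: if `p` precedes `q`, a value above `q` but not above `p` comes after `p` in `K`, so
-- `p` has already occurred as a value, and that earlier generator tells `p` from `q`. Hence the
-- parameters of the words stand for all elements of `K`, since join-irreducibles have to be
-- compared with arbitrary values. In the converse direction `ρ` is never given as a map on `L`: it
-- is read off from generators at which the elements of `L` first occur, and `Θ` is recovered as a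
-- set of pairs, which is all that a coloring sees.

open import Defs
open import Algebra.Lattice.Bundles using (DistributiveLattice)
open import Algebra.Lattice.Morphism.Structures using (IsLatticeIsomorphism)
import Algebra.Lattice.Properties.Lattice as LatticeProperties
open import Data.Bool.Base using (Bool; true; false) renaming (_∧_ to _&&_; _∨_ to _||_)
import Data.Bool.Properties as Bool
open import Data.Fin.Base using (Fin; zero; suc; toℕ; combine; funToFin; finToFun) renaming (_<_ to _<ᶠ_)
import Data.Fin.Properties as Fin
open import Data.List.Base using (List; []; _∷_; _++_; map; length; lookup; allFin; cartesianProductWith; filter; foldr)
open import Data.List.Membership.Propositional using (_∈_; find)
open import Data.List.Membership.Propositional.Properties
  using (∈-map⁺; ∈-map⁻; ∈-++⁺ˡ; ∈-++⁺ʳ; ∈-allFin; ∈-cartesianProductWith⁺; ∈-filter⁺; ∈-filter⁻; ∈-lookup)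
import Data.List.Membership.Setoid as SetoidMembership
import Data.List.Membership.Setoid.Properties as SetoidMembershipₚ
open import Data.List.Relation.Unary.All as All using (All; []; _∷_)
open import Data.List.Relation.Unary.AllPairs using (AllPairs; []; _∷_)
open import Data.List.Relation.Unary.Any as Any using (Any; here; there; index)
open import Data.List.Relation.Unary.Any.Properties using (lookup-index)
open import Data.Nat.Base as ℕ using (ℕ; zero; suc; _+_; _^_; z≤n; s≤s; z<s; s<s; s<s⁻¹; s≤s⁻¹)
open import Data.Nat.Induction using (<-wellFounded)
import Data.Nat.Properties as ℕ
open import Data.Product.Base using (Σ-syntax; ∃-syntax; _×_; _,_; proj₁; proj₂)
open import Data.Sum.Base as Sum using (_⊎_; inj₁; inj₂; [_,_])
open import Data.Vec.Base as Vec using (Vec; []; _∷_; tabulate)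
import Data.Vec.Properties as Vec
open import Function.Base using (id; _∘_; _on_)
open import Function.Bundles using (Func; mk⇔; Equivalence)
open import Induction.WellFounded using (WellFounded; Acc; acc)
open import Level using (0ℓ)
open import Relation.Binary.Bundles using (Setoid)
import Relation.Binary.Construct.On as On
open import Relation.Binary.Core using (Rel)
open import Relation.Binary.Definitions using (_Respects_; Tri; tri<; tri≈; tri>; Trichotomous)
import Relation.Binary.Lattice.Structures as OrderTheory
open import Relation.Binary.Morphism.Structures using (IsOrderIsomorphism)
open import Relation.Binary.PropositionalEquality as ≡ using (_≡_; _≗_)
open import Relation.Binary.Structures using (IsStrictTotalOrder)
open import Relation.Nullary using (¬_; Dec; yes; no; does; contradiction)
open import Relation.Nullary.Decidable using (map′; dec-true; ¬?; _×-dec_; _→-dec_; decidable-stable)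
open import Relation.Unary using (Pred)
import Relation.Unary as U

-- Parameter words and the dual Ramsey theorem

module Words where
  open ≡ using (refl; sym; trans; cong; cong₂; subst)

  Listed : Set → Set
  Listed X = Σ[ xs ∈ List X ] (∀ x → x ∈ xs)

  funToFin-cong : ∀ {s r} {f g : Fin s → Fin r} → f ≗ g → funToFin f ≡ funToFin g
  funToFin-cong {zero}  f≗g = refl
  funToFin-cong {suc s} f≗g = cong₂ combine (f≗g zero) (funToFin-cong (f≗g ∘ suc))

  -- The product argument of Ramsey theory: in a coloring of pairs, the color of one coordinate is
  -- taken to be the whole function of the other, coded as one of `r ^ length xs` colors. Equal
  -- codes then give equality for all values of the other coordinate at once.
  module Bundle {X : Set} (X-listed : Listed X) {r : ℕ} where

    private
      xs = proj₁ X-listed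

    abstract
      bundle : (X → Fin r) → Fin (r ^ length xs)
      bundle f = funToFin (f ∘ lookup xs)

      bundle-cong : ∀ {f g} → f ≗ g → bundle f ≡ bundle g
      bundle-cong f≗g = funToFin-cong (f≗g ∘ lookup xs)

      bundle-injective : ∀ {f g} → bundle f ≡ bundle g → f ≗ g
      bundle-injective {f} {g} eq x =
        subst (λ y → f y ≡ g y) (sym (lookup-index x∈xs))
          (trans (sym (Fin.finToFun-funToFin (f ∘ lookup xs) i))
            (trans (cong (λ c → finToFun c i) eq) (Fin.finToFun-funToFin (g ∘ lookup xs) i)))
        where
        x∈xs : x ∈ xs
        x∈xs = proj₂ X-listed x

        i : Fin (length xs)
        i = index x∈xs

  -- Word t n m: the m-parameter words of length n over Fin t.  The parameters
  -- are numbered in the order of their first occurrences; from its first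
  -- occurrence on, a parameter is an additional letter, with de Bruijn index 0.
  data Word (t : ℕ) : ℕ → ℕ → Set where
    []  : Word t 0 0
    lit : ∀ {n m} → Fin t → Word t n m → Word t (suc n) m
    new : ∀ {n m} → Word (suc t) n m → Word t (suc n) (suc m)

  private
    variable
      s t u n n′ m m′ k k′ r : ℕ
      X Y : Set

  infixr 5 _▹_

  _▹_ : {X : Set} → X → (Fin t → X) → Fin (suc t) → X
  (x ▹ e) zero    = x
  (x ▹ e) (suc i) = e i

  ▹-cong : {X : Set} (x : X) {e e′ : Fin t → X} → e ≗ e′ → (x ▹ e) ≗ (x ▹ e′)
  ▹-cong x eq zero    = refl
  ▹-cong x eq (suc i) = eq i

  ▹-∘ : {X Y : Set} (g : X → Y) (x : X) (e : Fin t → X) → g ∘ (x ▹ e) ≗ (g x ▹ g ∘ e)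
  ▹-∘ g x e zero    = refl
  ▹-∘ g x e (suc i) = refl

  lift : (Fin s → Fin t) → Fin (suc s) → Fin (suc t)
  lift e = zero ▹ suc ∘ e

  lift-cong : {e e′ : Fin s → Fin t} → e ≗ e′ → lift e ≗ lift e′
  lift-cong eq = ▹-cong zero (cong suc ∘ eq)

  lift-∘ : (f : Fin t → Fin u) (e : Fin s → Fin t) → lift f ∘ lift e ≗ lift (f ∘ e)
  lift-∘ f e zero    = refl
  lift-∘ f e (suc i) = refl

  lift-id : lift {s} id ≗ id
  lift-id zero    = refl
  lift-id (suc i) = refl

  ren : (Fin s → Fin t) → Word s n m → Word t n m
  ren e []        = []
  ren e (lit a w) = lit (e a) (ren e w)
  ren e (new w)   = new (ren (lift e) w)

  weaken : Word t n m → Word (suc t) n m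
  weaken = ren suc

  -- The letters of w are read through e, its parameters are replaced by the
  -- successive letters of v.
  sub : (Fin s → Fin t) → Word s n m → Word t m k → Word t n k
  sub e []        []        = []
  sub e (lit a w) v         = lit (e a) (sub e w v)
  sub e (new w)   (lit a v) = lit a (sub (a ▹ e) w v)
  sub e (new w)   (new v)   = new (sub (lift e) w v)

  infixl 6 _·_

  _·_ : Word t n m → Word t m k → Word t n k
  _·_ = sub id

  ren-cong : {e e′ : Fin s → Fin t} → e ≗ e′ → (w : Word s n m) → ren e w ≡ ren e′ w
  ren-cong eq []        = refl
  ren-cong eq (lit a w) = cong₂ lit (eq a) (ren-cong eq w)
  ren-cong eq (new w)   = cong new (ren-cong (lift-cong eq) w)

  sub-cong : {e e′ : Fin s → Fin t} → e ≗ e′ →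
             (w : Word s n m) (v : Word t m k) → sub e w v ≡ sub e′ w v
  sub-cong eq []        []        = refl
  sub-cong eq (lit a w) v         = cong₂ lit (eq a) (sub-cong eq w v)
  sub-cong eq (new w)   (lit a v) = cong (lit a) (sub-cong (▹-cong a eq) w v)
  sub-cong eq (new w)   (new v)   = cong new (sub-cong (lift-cong eq) w v)

  ren-sub : (f : Fin t → Fin u) (e : Fin s → Fin t) (w : Word s n m) (v : Word t m k) →
            ren f (sub e w v) ≡ sub (f ∘ e) w (ren f v)
  ren-sub f e []        []        = refl
  ren-sub f e (lit a w) v         = cong (lit _) (ren-sub f e w v)
  ren-sub f e (new w)   (lit a v) =
    cong (lit _) (trans (ren-sub f (a ▹ e) w v) (sub-cong (▹-∘ f a e) w (ren f v)))
  ren-sub f e (new w)   (new v)   =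
    cong new (trans (ren-sub (lift f) (lift e) w v) (sub-cong (lift-∘ f e) w (ren (lift f) v)))

  sub-ren : (e : Fin t → Fin u) (f : Fin s → Fin t) (w : Word s n m) (v : Word u m k) →
            sub e (ren f w) v ≡ sub (e ∘ f) w v
  sub-ren e f []        []        = refl
  sub-ren e f (lit a w) v         = cong (lit _) (sub-ren e f w v)
  sub-ren e f (new w)   (lit a v) =
    cong (lit a) (trans (sub-ren (a ▹ e) (lift f) w v) (sub-cong eq w v))
    where
    eq : (a ▹ e) ∘ lift f ≗ (a ▹ e ∘ f)
    eq zero    = refl
    eq (suc i) = refl
  sub-ren e f (new w)   (new v)   =
    cong new (trans (sub-ren (lift e) (lift f) w v) (sub-cong (lift-∘ e f) w v))

  -- Environments grow at every `new`, so associativity has to be proved for arbitrary `d` and `e`;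
  -- `·-assoc` is the case of identities.
  sub-sub : (d : Fin t → Fin u) (e : Fin s → Fin t)
            (w : Word s n m) (v : Word t m k) (x : Word u k k′) →
            sub d (sub e w v) x ≡ sub (d ∘ e) w (sub d v x)
  sub-sub d e []        []        []        = refl
  sub-sub d e (lit a w) v         x         = cong (lit _) (sub-sub d e w v x)
  sub-sub d e (new w)   (lit a v) x         =
    cong (lit _) (trans (sub-sub d (a ▹ e) w v x) (sub-cong (▹-∘ d a e) w (sub d v x)))
  sub-sub d e (new w)   (new v)   (lit a x) =
    cong (lit a) (trans (sub-sub (a ▹ d) (lift e) w v x) (sub-cong eq w (sub (a ▹ d) v x)))
    where
    eq : (a ▹ d) ∘ lift e ≗ (a ▹ d ∘ e)
    eq zero    = refl
    eq (suc i) = refl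
  sub-sub d e (new w)   (new v)   (new x)   =
    cong new (trans (sub-sub (lift d) (lift e) w v x) (sub-cong (lift-∘ d e) w (sub (lift d) v x)))

  ·-assoc : (w : Word t n m) (v : Word t m k) (x : Word t k k′) → w · v · x ≡ w · (v · x)
  ·-assoc = sub-sub id id

  weaken-sub : (a : Fin t) (w : Word t n m) (v : Word t m k) →
               sub (a ▹ id) (weaken w) v ≡ w · v
  weaken-sub a w v = sub-ren (a ▹ id) suc w v

  infixr 5 _⊹_

  -- Concatenation with separate parameters: `weaken` hides those of `w` from `v`, so that the two
  -- halves can be filled in independently (`sub-⊹`).
  _⊹_ : Word t n m → Word t n′ m′ → Word t (n + n′) (m + m′)
  []      ⊹ v = v
  lit a w ⊹ v = lit a (w ⊹ v)
  new w   ⊹ v = new (w ⊹ weaken v)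

  sub-⊹ : (e : Fin s → Fin t) (w : Word s n m) (v : Word s n′ m′)
          (x : Word t m k) (y : Word t m′ k′) →
          sub e (w ⊹ v) (x ⊹ y) ≡ sub e w x ⊹ sub e v y
  sub-⊹ e []        v []        y = refl
  sub-⊹ e (lit a w) v x         y = cong (lit _) (sub-⊹ e w v x y)
  sub-⊹ e (new w)   v (lit a x) y = cong (lit a)
    (trans (sub-⊹ (a ▹ e) w (weaken v) x y)
           (cong (sub (a ▹ e) w x ⊹_) (sub-ren (a ▹ e) suc v y)))
  sub-⊹ e (new w)   v (new x)   y = cong new
    (trans (sub-⊹ (lift e) w (weaken v) x (weaken y))
           (cong (sub (lift e) w x ⊹_)
             (trans (sub-ren (lift e) suc v (weaken y)) (sym (ren-sub suc e v y)))))

  line-⊹ : (ℓ : Word t n 1) (v : Word t n′ m) (a : Fin t) (y : Word t m k) →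
           (ℓ ⊹ v) · lit a y ≡ (ℓ · lit a []) ⊹ (v · y)
  line-⊹ ℓ v a y = sub-⊹ id ℓ v (lit a []) y

  abstract
    words : ∀ t n m → Listed (Word t n m)
    words t zero    zero    = [] ∷ [] , λ { [] → here refl }
    words t zero    (suc m) = [] , λ ()
    words t (suc n) zero    =
      cartesianProductWith lit (allFin t) (proj₁ (words t n zero)) ,
      λ { (lit a w) → ∈-cartesianProductWith⁺ lit (∈-allFin a) (proj₂ (words t n zero) w) }
    words t (suc n) (suc m) =
      lits ++ map new (proj₁ (words (suc t) n m)) ,
      λ { (lit a w) → ∈-++⁺ˡ (∈-cartesianProductWith⁺ lit (∈-allFin a) (proj₂ (words t n (suc m)) w))
        ; (new w)   → ∈-++⁺ʳ lits (∈-map⁺ new (proj₂ (words (suc t) n m) w)) }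
      where
      lits : List (Word t (suc n) (suc m))
      lits = cartesianProductWith lit (allFin t) (proj₁ (words t n (suc m)))

  -- Shelah's proof of the Hales–Jewett theorem: by the pigeonhole principle two of
  -- the words a…ab…b have the same colour, so exchanging a and b in the line between
  -- them does not matter, and the alphabet loses a letter.

  HalesJewett : ℕ → Set
  HalesJewett t = ∀ r → ∃[ n ] ((χ : Word t n 0 → Fin r) →
    Σ[ ℓ ∈ Word t n 1 ] (∀ a b → χ (ℓ · lit a []) ≡ χ (ℓ · lit b [])))

  step : (a b : Fin t) (n : ℕ) → Fin (suc n) → Word t n 0
  step a b zero    _       = []
  step a b (suc n) zero    = lit b (step a b n zero)
  step a b (suc n) (suc i) = lit a (step a b n i)

  -- The letter `a` up to position `i`, the parameter from `i` to `j`, then `b`. Its values at `a`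
  -- and at `b` are the step words of `j` and of `i`.
  stepLine : (a b : Fin t) (n : ℕ) (i j : Fin (suc n)) → i <ᶠ j → Word t n 1
  stepLine a b (suc n) zero    (suc j) _   = new (step zero (suc b) n j)
  stepLine a b (suc n) (suc i) (suc j) i<j = lit a (stepLine a b n i j (s<s⁻¹ i<j))

  sub-step : (e : Fin s → Fin t) (a b : Fin s) (n : ℕ) (i : Fin (suc n)) →
             sub e (step a b n i) [] ≡ step (e a) (e b) n i
  sub-step e a b zero    i       = refl
  sub-step e a b (suc n) zero    = cong (lit _) (sub-step e a b n zero)
  sub-step e a b (suc n) (suc i) = cong (lit _) (sub-step e a b n i)

  stepLine-a : (a b : Fin t) (n : ℕ) (i j : Fin (suc n)) (i<j : i <ᶠ j) →
               stepLine a b n i j i<j · lit a [] ≡ step a b n j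
  stepLine-a a b (suc n) zero    (suc j) _   = cong (lit a) (sub-step (a ▹ id) zero (suc b) n j)
  stepLine-a a b (suc n) (suc i) (suc j) i<j = cong (lit a) (stepLine-a a b n i j (s<s⁻¹ i<j))

  step-const : (a b : Fin t) (n : ℕ) (i : Fin (suc n)) → step b b n i ≡ step a b n zero
  step-const a b zero    i       = refl
  step-const a b (suc n) zero    = cong (lit b) (step-const a b n zero)
  step-const a b (suc n) (suc i) = cong (lit b) (step-const a b n i)

  stepLine-b : (a b : Fin t) (n : ℕ) (i j : Fin (suc n)) (i<j : i <ᶠ j) →
               stepLine a b n i j i<j · lit b [] ≡ step a b n i
  stepLine-b a b (suc n) zero    (suc j) _   =
    cong (lit b) (trans (sub-step (b ▹ id) zero (suc b) n j) (step-const a b n j))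
  stepLine-b a b (suc n) (suc i) (suc j) i<j = cong (lit a) (stepLine-b a b n i j (s<s⁻¹ i<j))

  merge : Fin (suc (suc t)) → Fin (suc (suc t))
  merge zero    = suc zero
  merge (suc a) = suc a

  -- Shelah's loss of a letter in dimension `m`: inside `p`, turning every letter zero of `x` into
  -- one keeps the color.
  Merging : ℕ → ℕ → ℕ → Set
  Merging t m r = ∃[ n ] ((χ : Word (suc (suc t)) n 0 → Fin r) →
    Σ[ p ∈ Word (suc (suc t)) n m ] (∀ x → χ (p · x) ≡ χ (p · ren merge x)))

  merging : ∀ t m r → Merging t m r
  merging t zero    r = 0 , λ χ → [] , λ { [] → refl }
  merging t (suc m) r = B + len , λ χ → search χ
    where
    T = suc (suc t)
    tails = words T m 0
    -- There are `suc B` step words and `B` colors, so two step words collide. The tail enters only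
    -- through `p`, hence the tails counted here have length `m`, and `B` is known before `len`,
    -- which depends on it.
    B = r ^ length (proj₁ tails)
    heads = words T B 0
    open Bundle heads {r} renaming (bundle to bundleʰ; bundle-injective to bundleʰ-injective)
    open Bundle tails {r} renaming (bundle to bundleᵗ; bundle-injective to bundleᵗ-injective)
    ih = merging t m (r ^ length (proj₁ heads))
    len = proj₁ ih

    search : (χ : Word T (B + len) 0 → Fin r) →
           Σ[ p ∈ Word T (B + len) (suc m) ] (∀ x → χ (p · x) ≡ χ (p · ren merge x))
    search χ with proj₂ ih (λ y → bundleʰ (λ u → χ (u ⊹ y)))
    ... | p , p-merges
      with Fin.pigeonhole (ℕ.n<1+n B) (λ i → bundleᵗ (λ x → χ (step zero (suc zero) B i ⊹ (p · x))))
    ... | i , j , i<j , same = ℓ ⊹ p , λ { (lit a x) → merges a x }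
      where
      ℓ = stepLine zero (suc zero) B i j i<j

      ℓ-merges : ∀ a x → χ ((ℓ · lit a []) ⊹ (p · x)) ≡ χ ((ℓ · lit (merge a) []) ⊹ (p · x))
      ℓ-merges zero    x =
        trans (cong (λ u → χ (u ⊹ (p · x))) (stepLine-a zero (suc zero) B i j i<j))
          (trans (sym (bundleᵗ-injective same x))
            (cong (λ u → χ (u ⊹ (p · x))) (sym (stepLine-b zero (suc zero) B i j i<j))))
      ℓ-merges (suc a) x = refl

      merges : ∀ a x → χ ((ℓ ⊹ p) · lit a x) ≡ χ ((ℓ ⊹ p) · lit (merge a) (ren merge x))
      merges a x =
        trans (cong χ (line-⊹ ℓ p a x))
          (trans (bundleʰ-injective (p-merges x) (ℓ · lit a []))
            (trans (ℓ-merges a (ren merge x))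
              (cong χ (sym (line-⊹ ℓ p (merge a) (ren merge x))))))

  -- Inside a merging word of dimension `dim` the nonzero letters form the smaller alphabet, over
  -- which a line is available. Its value at zero merges into its value at one, so the line serves
  -- the larger alphabet too.
  halesJewett-suc : HalesJewett (suc t) → HalesJewett (suc (suc t))
  halesJewett-suc {t} hj r = len , λ χ → search χ
    where
    ih = hj r
    dim = proj₁ ih
    len = proj₁ (merging t dim r)

    search : (χ : Word (suc (suc t)) len 0 → Fin r) →
           Σ[ ℓ ∈ Word (suc (suc t)) len 1 ] (∀ a b → χ (ℓ · lit a []) ≡ χ (ℓ · lit b []))
    search χ with proj₂ (merging t dim r) χ
    ... | p , p-merges with proj₂ ih (λ y → χ (p · ren suc y))
    ... | ℓ , ℓ-mono = p · ren suc ℓ , λ a b →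
            trans (to-suc a) (trans (ℓ-mono (pred a) (pred b)) (sym (to-suc b)))
      where
      pred : Fin (suc (suc t)) → Fin (suc t)
      pred zero    = zero
      pred (suc a) = a

      on-suc : ∀ a → p · ren suc ℓ · lit (suc a) [] ≡ p · ren suc (ℓ · lit a [])
      on-suc a = trans (·-assoc p (ren suc ℓ) (lit (suc a) []))
        (cong (p ·_) (trans (sub-ren id suc ℓ (lit (suc a) [])) (sym (ren-sub suc id ℓ (lit a [])))))

      on-zero : ren merge (ren suc ℓ · lit zero []) ≡ ren suc (ℓ · lit zero [])
      on-zero = trans (ren-sub merge id (ren suc ℓ) (lit zero []))
        (trans (sub-ren merge suc ℓ (lit (suc zero) [])) (sym (ren-sub suc id ℓ (lit zero []))))

      to-suc : ∀ a → χ (p · ren suc ℓ · lit a []) ≡ χ (p · ren suc (ℓ · lit (pred a) []))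
      to-suc (suc a) = cong χ (on-suc a)
      to-suc zero    =
        trans (cong χ (·-assoc p (ren suc ℓ) (lit zero [])))
          (trans (p-merges (ren suc ℓ · lit zero [])) (cong (χ ∘ (p ·_)) on-zero))

  halesJewett : ∀ t → HalesJewett t
  halesJewett zero          r = 1 , λ χ → new [] , λ ()
  halesJewett (suc zero)    r = 1 , λ χ → new [] , λ { zero zero → refl }
  halesJewett (suc (suc t)) = halesJewett-suc (halesJewett (suc t))

  -- The Graham–Rothschild theorem, by induction on the number of parameters of the
  -- coloured words.  The colour is made to depend only on the prefix before the
  -- first parameter, then only on the length of that prefix, then on nothing.

  GrahamRothschild : ℕ → ℕ → Set
  GrahamRothschild t k = ∀ m r → ∃[ n ] ((χ : Word t n k → Fin r) →
    Σ[ w ∈ Word t n m ] (∀ x y → χ (w · x) ≡ χ (w · y)))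

  -- The Hales-Jewett theorem in dimension `m`: a line for the head and a word for the tail, each
  -- uniform in all fillings of the other. As in `merging`, the head sees tails of length `m` only,
  -- which keeps the choice of lengths from being circular.
  grahamRothschild-zero : ∀ t → GrahamRothschild t 0
  grahamRothschild-zero t zero    r = 0 , λ χ → [] , λ { [] [] → refl }
  grahamRothschild-zero t (suc m) r = h + len , λ χ → search χ
    where
    tails = words t m 0
    open Bundle tails {r} renaming (bundle to bundleᵗ; bundle-injective to bundleᵗ-injective)
    hj = halesJewett t (r ^ length (proj₁ tails))
    h = proj₁ hj
    heads = words t h 0
    open Bundle heads {r} renaming (bundle to bundleʰ; bundle-injective to bundleʰ-injective)
    ih = grahamRothschild-zero t m (r ^ length (proj₁ heads))
    len = proj₁ ih

    search : (χ : Word t (h + len) 0 → Fin r) →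
           Σ[ w ∈ Word t (h + len) (suc m) ] (∀ x y → χ (w · x) ≡ χ (w · y))
    search χ with proj₂ ih (λ y → bundleʰ (λ u → χ (u ⊹ y)))
    ... | w , w-mono with proj₂ hj (λ u → bundleᵗ (λ x → χ (u ⊹ (w · x))))
    ... | ℓ , ℓ-mono = ℓ ⊹ w , λ { (lit a x) (lit b y) →
            trans (cong χ (line-⊹ ℓ w a x))
              (trans (bundleʰ-injective (w-mono x y) (ℓ · lit a []))
                (trans (bundleᵗ-injective (ℓ-mono a b) y) (cong χ (sym (line-⊹ ℓ w b y))))) }

  data SamePrefix {t : ℕ} : (x y : Word t n (suc k)) → Set where
    lit : (a : Fin t) {x y : Word t n (suc k)} → SamePrefix x y → SamePrefix (lit a x) (lit a y)
    new : {x y : Word (suc t) n k} → SamePrefix (new x) (new y)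

  prefix-⊹ : (w : Word t n 0) {x y : Word t n′ (suc k)} →
             SamePrefix x y → SamePrefix (w ⊹ x) (w ⊹ y)
  prefix-⊹ []        p = p
  prefix-⊹ (lit a w) p = lit a (prefix-⊹ w p)

  -- The first parameter of the result already occurs inside `ℓ`, so the prefix ends before `x` and
  -- `y` can matter.
  prefix-line : (e : Fin s → Fin t) (ℓ : Word s n 1) (w : Word s n′ m) (x y : Word (suc t) m k) →
                SamePrefix (sub e (ℓ ⊹ w) (new x)) (sub e (ℓ ⊹ w) (new y))
  prefix-line e (lit a ℓ) w x y = lit (e a) (prefix-line e ℓ w x y)
  prefix-line e (new ℓ)   w x y = new

  position : Word t n (suc k) → Fin n
  position (lit a x) = suc (position x)
  position (new x)   = zero

  first : Word t n m → Fin m → Fin n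
  first (lit a w) i       = suc (first w i)
  first (new w)   zero    = zero
  first (new w)   (suc i) = suc (first w i)

  first-ren : (e : Fin s → Fin t) (w : Word s n m) → first (ren e w) ≗ first w
  first-ren e (lit a w) i       = cong suc (first-ren e w i)
  first-ren e (new w)   zero    = refl
  first-ren e (new w)   (suc i) = cong suc (first-ren (lift e) w i)

  position-sub : (e : Fin s → Fin t) (w : Word s n m) (x : Word t m (suc k)) →
                 position (sub e w x) ≡ first w (position x)
  position-sub e (lit a w) x         = cong suc (position-sub e w x)
  position-sub e (new w)   (lit a x) = cong suc (position-sub (a ▹ e) w x)
  position-sub e (new w)   (new x)   = refl

  first-sub : (e : Fin s → Fin t) (w : Word s n m) (v : Word t m k) →
              first (sub e w v) ≗ first w ∘ first v
  first-sub e []        []        ()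
  first-sub e (lit a w) v         i       = cong suc (first-sub e w v i)
  first-sub e (new w)   (lit a v) i       = cong suc (first-sub (a ▹ e) w v i)
  first-sub e (new w)   (new v)   zero    = refl
  first-sub e (new w)   (new v)   (suc i) = cong suc (first-sub (lift e) w v i)

  PrefixColoured : (Word t n (suc k) → Fin r) → Set
  PrefixColoured χ = ∀ {x y} → SamePrefix x y → χ x ≡ χ y

  -- Fusion: the words of the coloured k + 1 parameters whose first parameter
  -- comes at once are k-parameter words over one more letter.
  prefixFusion : GrahamRothschild (suc t) k → ∀ m r → ∃[ n ] ((χ : Word t n (suc k) → Fin r) →
    Σ[ w ∈ Word t n m ] PrefixColoured (λ x → χ (w · x)))
  prefixFusion gr zero    r = 0 , λ χ → [] , λ { {()} }
  prefixFusion {t} {k} gr (suc m) r = suc len , λ χ → search χ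
    where
    open Bundle {Fin t} (allFin t , ∈-allFin) {r}
    ih = prefixFusion gr m (r ^ length (allFin t))
    n₁ = proj₁ ih
    len = proj₁ (gr n₁ r)

    search : (χ : Word t (suc len) (suc k) → Fin r) →
           Σ[ w ∈ Word t (suc len) (suc m) ] PrefixColoured (λ x → χ (w · x))
    search χ with proj₂ (gr n₁ r) (χ ∘ new)
    ... | v , v-mono with proj₂ ih (λ x → bundle (λ a → χ (new v · lit a x)))
    -- A leading letter leaves `w · x` to be filled in, which `w-prefix` controls; a leading
    -- parameter leaves a word within `new v`, where `v-mono` makes everything one color.
    ... | w , w-prefix = new v · new (weaken w) , coloured
      where
      on-lit : ∀ a x → χ (new v · new (weaken w) · lit a x) ≡ χ (new v · lit a (w · x))
      on-lit a x = cong χ (trans (·-assoc (new v) (new (weaken w)) (lit a x))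
        (cong (λ z → new v · lit a z) (weaken-sub a w x)))

      on-new : ∀ x → χ (new v · new (weaken w) · new x) ≡ χ (new (v · (weaken w · x)))
      on-new x = cong χ (trans (·-assoc (new v) (new (weaken w)) (new x))
        (cong new (trans (sub-cong lift-id v _)
          (cong (v ·_) (sub-cong lift-id (weaken w) x)))))

      coloured : PrefixColoured (λ x → χ (new v · new (weaken w) · x))
      coloured (lit a {x} {y} p) =
        trans (on-lit a x) (trans (bundle-injective (w-prefix p) a) (sym (on-lit a y)))
      coloured (new {x = x} {y}) = trans (on-new x) (trans (v-mono _ _) (sym (on-new y)))

  -- What remains to be forgotten is the letters before the first parameter. Every coordinate is a
  -- Hales-Jewett line, so a letter put there is immaterial; once a coordinate holds the first
  -- parameter, prefix coloring disposes of the rest.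
  positionFusion : ∀ t k m r → ∃[ n ] ((χ : Word t n (suc k) → Fin r) → PrefixColoured χ →
    Σ[ w ∈ Word t n m ] (∀ x y → position x ≡ position y → χ (w · x) ≡ χ (w · y)))
  positionFusion t k zero    r = 0 , λ χ _ → [] , λ ()
  positionFusion t k (suc m) r = h + len , λ χ χ-prefix → search χ χ-prefix
    where
    tails = words t m (suc k)
    open Bundle tails {r} renaming (bundle to bundleᵗ; bundle-injective to bundleᵗ-injective)
    hj = halesJewett t (r ^ length (proj₁ tails))
    h = proj₁ hj
    heads = words t h 0
    open Bundle heads {r}
      renaming (bundle to bundleʰ; bundle-injective to bundleʰ-injective; bundle-cong to bundleʰ-cong)
    ih = positionFusion t k m (r ^ length (proj₁ heads))
    len = proj₁ ih

    search : (χ : Word t (h + len) (suc k) → Fin r) → PrefixColoured χ →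
           Σ[ w ∈ Word t (h + len) (suc m) ]
             (∀ x y → position x ≡ position y → χ (w · x) ≡ χ (w · y))
    search χ χ-prefix
      with proj₂ ih (λ y → bundleʰ (λ u → χ (u ⊹ y)))
                    (λ p → bundleʰ-cong (λ u → χ-prefix (prefix-⊹ u p)))
    ... | w , w-position with proj₂ hj (λ u → bundleᵗ (λ x → χ (u ⊹ (w · x))))
    ... | ℓ , ℓ-mono = ℓ ⊹ w , λ
            { (lit a x) (lit b y) eq →
                trans (cong χ (line-⊹ ℓ w a x))
                  (trans (bundleʰ-injective (w-position x y (Fin.suc-injective eq)) (ℓ · lit a []))
                    (trans (bundleᵗ-injective (ℓ-mono a b) y) (cong χ (sym (line-⊹ ℓ w b y)))))
            ; (new x) (new y) eq → χ-prefix (prefix-line id ℓ w x y) }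

  blank : ∀ n → Word (suc t) n 0
  blank zero    = []
  blank (suc n) = lit zero (blank n)

  -- The pigeonhole principle for two classes. The selected positions are recorded as first
  -- occurrences of parameters, and the others are filled with the letter zero of the nonempty
  -- alphabet.
  split : ∀ n m m′ → m + m′ ℕ.≤ n → {P : U.Pred (Fin n) 0ℓ} → U.Decidable P →
          (Σ[ w ∈ Word (suc t) n m ] (∀ i → P (first w i))) ⊎
          (Σ[ w ∈ Word (suc t) n m′ ] (∀ i → ¬ P (first w i)))
  split n       zero    m′       _  P? = inj₁ (blank n , λ ())
  split n       (suc m) zero     _  P? = inj₂ (blank n , λ ())
  split (suc n) (suc m) (suc m′) (s≤s le) {P} P? with P? zero
  ... | yes p₀ with split n m (suc m′) le (P? ∘ suc)
  ...   | inj₁ (w , p) = inj₁ (new (weaken w) , λ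
            { zero → p₀ ; (suc i) → subst (P ∘ suc) (sym (first-ren suc w i)) (p i) })
  ...   | inj₂ (w , p) = inj₂ (lit zero w , p)
  split (suc n) (suc m) (suc m′) (s≤s le) {P} P? | no ¬p₀
    with split n (suc m) m′ (subst (ℕ._≤ n) (ℕ.+-suc m m′) le) (P? ∘ suc)
  ... | inj₁ (w , p) = inj₁ (lit zero w , p)
  ... | inj₂ (w , p) = inj₂ (new (weaken w) , λ
            { zero → ¬p₀ ; (suc i) → subst (¬_ ∘ P ∘ suc) (sym (first-ren suc w i)) (p i) })

  monochromaticPositions : ∀ r m → ∃[ n ] ((c : Fin n → ℕ) → (∀ i → c i ℕ.< r) →
    Σ[ w ∈ Word (suc t) n m ] (∀ i j → c (first w i) ≡ c (first w j)))
  -- Length one rather than zero: a position must exist for the absence of colors to be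
  -- contradictory.
  monochromaticPositions zero    m = 1 , λ c c< → contradiction (c< zero) λ ()
  monochromaticPositions {t} (suc r) m = m + len , λ c c< → search c c<
    where
    ih = monochromaticPositions {t} r m
    len = proj₁ ih

    search : (c : Fin (m + len) → ℕ) → (∀ i → c i ℕ.< suc r) →
           Σ[ w ∈ Word (suc t) (m + len) m ] (∀ i j → c (first w i) ≡ c (first w j))
    -- Either `m` positions have the last color `r`, or `len` positions avoid it and one color is
    -- gone.
    search c c< with split (m + len) m len ℕ.≤-refl (λ i → c i ℕ.≟ r)
    ... | inj₁ (w , c≡r) = w , λ i j → trans (c≡r i) (sym (c≡r j))
    ... | inj₂ (w , c≢r)
      with proj₂ ih (c ∘ first w) (λ i → ℕ.≤∧≢⇒< (s≤s⁻¹ (c< (first w i))) (c≢r i))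
    ... | v , v-mono = w · v , λ i j →
            trans (cong c (first-sub id w v i))
              (trans (v-mono i j) (cong c (sym (first-sub id w v j))))

  grahamRothschild : ∀ t k → GrahamRothschild (suc t) k
  grahamRothschild t zero    m r = grahamRothschild-zero (suc t) m r
  grahamRothschild t (suc k) m r = proj₁ prefixes , λ χ → search χ
    where
    -- The lengths are fixed from the last reduction to the first: each word needs as many
    -- parameters as the next one has letters.
    monos = monochromaticPositions {t} (suc r) m
    positions = positionFusion (suc t) k (proj₁ monos) r
    prefixes = prefixFusion (grahamRothschild (suc t) k) (proj₁ positions) r

    -- The colour of a position, shifted by one: 0 is for the positions at which
    -- no word has its first parameter.
    module _ (χ : Word (suc t) n (suc k) → Fin r)
             (χ-position : ∀ x y → position x ≡ position y → χ x ≡ χ y) where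

      at? = λ i → Any.any? (λ x → position x Fin.≟ i) (proj₁ (words (suc t) n (suc k)))

      colour : Fin n → ℕ
      colour i with at? i
      ... | yes found = suc (toℕ (χ (proj₁ (Any.satisfied found))))
      ... | no _      = 0

      colour< : ∀ i → colour i ℕ.< suc r
      colour< i with at? i
      ... | yes found = s≤s (Fin.toℕ<n (χ (proj₁ (Any.satisfied found))))
      ... | no _      = z<s

      colour-position : ∀ x → colour (position x) ≡ suc (toℕ (χ x))
      colour-position x with at? (position x)
      ... | yes found = cong (suc ∘ toℕ) (χ-position _ x (proj₂ (Any.satisfied found)))
      ... | no none   =
        contradiction (Any.map (λ { refl → refl }) (proj₂ (words (suc t) n (suc k)) x)) none

    search : (χ : Word (suc t) (proj₁ prefixes) (suc k) → Fin r) →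
           Σ[ w ∈ Word (suc t) (proj₁ prefixes) m ] (∀ x y → χ (w · x) ≡ χ (w · y))
    search χ with proj₂ prefixes χ
    ... | w , w-prefix with proj₂ positions (λ x → χ (w · x)) w-prefix
    ... | v , v-position with proj₂ monos (colour (λ x → χ (w · (v · x))) v-position) (colour< _ v-position)
    ... | p , p-mono = w · v · p , λ x y → Fin.toℕ-injective (ℕ.suc-injective
            (trans (eq x) (trans (p-mono (position x) (position y)) (sym (eq y)))))
      where
      eq : ∀ x → suc (toℕ (χ (w · v · p · x))) ≡
                 colour (λ x → χ (w · (v · x))) v-position (first p (position x))
      eq x = trans (cong (suc ∘ toℕ ∘ χ)
                     (trans (·-assoc (w · v) p x) (·-assoc w v (p · x))))
               (trans (sym (colour-position (λ x → χ (w · (v · x))) v-position (p · x)))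
                 (cong (colour (λ x → χ (w · (v · x))) v-position) (position-sub id p x)))

  word-length : Word t n m → m ℕ.≤ n
  word-length []        = z≤n
  word-length (lit a w) = ℕ.m≤n⇒m≤1+n (word-length w)
  word-length (new w)   = s≤s (word-length w)

  someWord : m ℕ.≤ n → Word (suc t) n m
  someWord {n = n} z≤n     = blank n
  someWord         (s≤s p) = new (someWord p)

  -- Rigid surjections are the words over the empty alphabet; over the nonempty
  -- base they begin with a new parameter.
  dualRamsey : ∀ l m r → ∃[ n ] ((χ : Word 0 n (suc m) → Fin (suc r)) →
    Σ[ w ∈ Word 0 n (suc l) ] ∃[ c ] (∀ x → χ (w · x) ≡ c))
  dualRamsey l m r = suc (proj₁ gr) , λ χ → search χ
    where
    gr = grahamRothschild 0 m l (suc r)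

    search : (χ : Word 0 (suc (proj₁ gr)) (suc m) → Fin (suc r)) →
           Σ[ w ∈ Word 0 (suc (proj₁ gr)) (suc l) ] ∃[ c ] (∀ x → χ (w · x) ≡ c)
    search χ with proj₂ gr (χ ∘ new)
    ... | w , w-mono with m ℕ.≤? l
    ...   | yes m≤l = new w , χ (new (w · someWord m≤l)) , λ { (new x) →
              trans (cong (χ ∘ new) (sub-cong lift-id w x)) (w-mono x (someWord m≤l)) }
    -- No word `x` exists here, yet a color has to be named; `suc r` provides zero.
    ...   | no m≰l  = new w , zero , λ { (new x) → contradiction (word-length x) m≰l }

  -- Words as rigid surjections

  at : Word t n m → (Fin t → X) → (Fin m → X) → Fin n → X
  at (lit a w) e f zero    = e a
  at (lit a w) e f (suc i) = at w e f i
  at (new w)   e f zero    = f zero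
  at (new w)   e f (suc i) = at w (f zero ▹ e) (f ∘ suc) i

  -- `at` merely copies letters and parameters, so a relation between two readings passes to all
  -- positions. Equality gives congruence; the graph of a map carries values from one lattice to
  -- another.
  at-parametric : (R : X → Y → Set) (w : Word t n m)
                  {e : Fin t → X} {e′ : Fin t → Y} {f : Fin m → X} {f′ : Fin m → Y} →
                  (∀ a → R (e a) (e′ a)) → (∀ b → R (f b) (f′ b)) →
                  ∀ i → R (at w e f i) (at w e′ f′ i)
  at-parametric R (lit a w) re rf zero    = re a
  at-parametric R (lit a w) re rf (suc i) = at-parametric R w re rf i
  at-parametric R (new w)   re rf zero    = rf zero
  at-parametric R (new w)   re rf (suc i) =
    at-parametric R w (λ { zero → rf zero ; (suc a) → re a }) (rf ∘ suc) i

  at-sub : (d : Fin s → Fin t) (w : Word s n m) (v : Word t m k) (e : Fin t → X) (f : Fin k → X) →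
           at (sub d w v) e f ≗ at w (e ∘ d) (at v e f)
  at-sub d (lit a w) v         e f zero    = refl
  at-sub d (lit a w) v         e f (suc i) = at-sub d w v e f i
  at-sub d (new w)   (lit a v) e f zero    = refl
  at-sub d (new w)   (lit a v) e f (suc i) = trans (at-sub (a ▹ d) w v e f i)
    (at-parametric _≡_ w (▹-∘ e a d) (λ _ → refl) i)
  at-sub d (new w)   (new v)   e f zero    = refl
  at-sub d (new w)   (new v)   e f (suc i) = trans (at-sub (lift d) w v (f zero ▹ e) (f ∘ suc) i)
    (at-parametric _≡_ w (λ { zero → refl ; (suc a) → refl }) (λ _ → refl) i)

  at-first : (w : Word t n m) (e : Fin t → X) (f : Fin m → X) (b : Fin m) →
             at w e f (first w b) ≡ f b
  at-first (lit a w) e f b       = at-first w e f b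
  at-first (new w)   e f zero    = refl
  at-first (new w)   e f (suc b) = at-first w (f zero ▹ e) (f ∘ suc) b

  -- The last component is the rigidity of words: where a parameter occurs, all earlier parameters
  -- have occurred before.
  at-image : (w : Word t n m) (e : Fin t → X) (f : Fin m → X) (i : Fin n) →
             (∃[ a ] at w e f i ≡ e a) ⊎
             (∃[ b ] at w e f i ≡ f b × (∀ {b′} → b′ <ᶠ b → first w b′ <ᶠ i))
  at-image (lit a w) e f zero    = inj₁ (a , refl)
  at-image (lit a w) e f (suc i) with at-image w e f i
  ... | inj₁ (a′ , eq)    = inj₁ (a′ , eq)
  ... | inj₂ (b , eq , h) = inj₂ (b , eq , λ b′<b → s<s (h b′<b))
  at-image (new w)   e f zero    = inj₂ (zero , refl , λ ())
  at-image (new w)   e f (suc i) with at-image w (f zero ▹ e) (f ∘ suc) i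
  ... | inj₁ (zero , eq)  = inj₂ (zero , eq , λ ())
  ... | inj₁ (suc a , eq) = inj₁ (a , eq)
  ... | inj₂ (b , eq , h) = inj₂ (suc b , eq , λ
          { {zero} _ → z<s ; {suc b′} b′<b → s<s (h (s<s⁻¹ b′<b)) })

  module _ (S : Setoid 0ℓ 0ℓ) where
    open Setoid S using (Carrier; _≈_) renaming (sym to ≈-sym; trans to ≈-trans)

    -- After its first occurrence a parameter becomes a letter, so the induction moves `f zero` into
    -- `e`. The condition `ordered` forces the first value outside `e` to be `f zero`.
    toWord : (e : Fin t → Carrier) (f : Fin m → Carrier) (g : Fin n → Carrier) →
             (∀ a b → ¬ (e a ≈ f b)) → (∀ {b b′} → f b ≈ f b′ → b ≡ b′) →
             (∀ i → (∃[ a ] e a ≈ g i) ⊎ (∃[ b ] f b ≈ g i)) →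
             (∀ b → ∃[ i ] g i ≈ f b) →
             (∀ {i b b′} → f b ≈ g i → b′ <ᶠ b → ∃[ i′ ] (i′ <ᶠ i × g i′ ≈ f b′)) →
             Σ[ w ∈ Word t n m ] (∀ i → at w e f i ≈ g i)
    toWord {m = zero}  {n = zero}  e f g fresh inj covers hits ordered = [] , λ ()
    toWord {m = suc m} {n = zero}  e f g fresh inj covers hits ordered with hits zero
    ... | () , _
    toWord             {n = suc n} e f g fresh inj covers hits ordered with covers zero
    ... | inj₁ (a , ea≈g0) = lit a (proj₁ rest) , λ { zero → ea≈g0 ; (suc i) → proj₂ rest i }
      where
      hits′ : ∀ b → ∃[ i ] g (suc i) ≈ f b
      hits′ b with hits b
      ... | zero  , eq = contradiction (≈-trans ea≈g0 eq) (fresh a b)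
      ... | suc i , eq = i , eq

      ordered′ : ∀ {i b b′} → f b ≈ g (suc i) → b′ <ᶠ b → ∃[ i′ ] (i′ <ᶠ i × g (suc i′) ≈ f b′)
      ordered′ fb≈gi b′<b with ordered fb≈gi b′<b
      ... | zero   , _    , eq = contradiction (≈-trans ea≈g0 eq) (fresh a _)
      ... | suc i′ , i′<i , eq = i′ , s<s⁻¹ i′<i , eq

      rest = toWord e f (g ∘ suc) fresh inj (covers ∘ suc) hits′ ordered′
    toWord             {n = suc n} e f g fresh inj covers hits ordered | inj₂ (suc b , fb≈g0)
      with ordered {b′ = zero} fb≈g0 z<s
    ... | _ , () , _
    toWord {t = t} {m = suc m} {n = suc n} e f g fresh inj covers hits ordered | inj₂ (zero , f0≈g0) =
      new (proj₁ rest) , λ { zero → f0≈g0 ; (suc i) → proj₂ rest i }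
      where
      fresh′ : ∀ a b → ¬ ((f zero ▹ e) a ≈ f (suc b))
      fresh′ zero    b eq = contradiction (inj eq) λ ()
      fresh′ (suc a) b eq = fresh a (suc b) eq

      covers′ : ∀ i → (∃[ a ] (f zero ▹ e) a ≈ g (suc i)) ⊎ (∃[ b ] f (suc b) ≈ g (suc i))
      covers′ i with covers (suc i)
      ... | inj₁ (a , eq)     = inj₁ (suc a , eq)
      ... | inj₂ (zero , eq)  = inj₁ (zero , eq)
      ... | inj₂ (suc b , eq) = inj₂ (b , eq)

      hits′ : ∀ b → ∃[ i ] g (suc i) ≈ f (suc b)
      hits′ b with hits (suc b)
      ... | zero  , eq = contradiction (inj (≈-trans f0≈g0 eq)) λ ()
      ... | suc i , eq = i , eq

      ordered′ : ∀ {i b b′} → f (suc b) ≈ g (suc i) → b′ <ᶠ b →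
                 ∃[ i′ ] (i′ <ᶠ i × g (suc i′) ≈ f (suc b′))
      ordered′ fb≈gi b′<b with ordered fb≈gi (s<s b′<b)
      ... | zero   , _    , eq = contradiction (inj (≈-trans f0≈g0 eq)) λ ()
      ... | suc i′ , i′<i , eq = i′ , s<s⁻¹ i′<i , eq

      rest = toWord (f zero ▹ e) (f ∘ suc) (g ∘ suc) fresh′ (Fin.suc-injective ∘ inj) covers′ hits′ ordered′

open Words

-- Finite distributive lattices and their congruences

module _ {A : Set} {P Q : Pred A 0ℓ} (P? : U.Decidable P) (Q? : U.Decidable Q) (P⊆Q : ∀ {x} → P x → Q x) where

  length-filter-mono : ∀ xs → length (filter P? xs) ℕ.≤ length (filter Q? xs)
  length-filter-mono []       = z≤n
  length-filter-mono (x ∷ xs) with P? x | Q? x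
  ... | yes _ | yes _ = s≤s (length-filter-mono xs)
  ... | yes p | no ¬q = contradiction (P⊆Q p) ¬q
  ... | no _  | yes _ = ℕ.m≤n⇒m≤1+n (length-filter-mono xs)
  ... | no _  | no _  = length-filter-mono xs

  length-filter-< : ∀ {xs} → Any (λ x → Q x × ¬ P x) xs →
                    length (filter P? xs) ℕ.< length (filter Q? xs)
  length-filter-< {x ∷ xs} h with P? x | Q? x | h
  ... | yes p | _     | here (_ , ¬p) = contradiction p ¬p
  ... | no _  | yes _ | here _        = s≤s (length-filter-mono xs)
  ... | no _  | no ¬q | here (q , _)  = contradiction q ¬q
  ... | yes _ | yes _ | there h′      = s≤s (length-filter-< h′)
  ... | yes p | no ¬q | there _       = contradiction (P⊆Q p) ¬q
  ... | no _  | yes _ | there h′      = ℕ.m≤n⇒m≤1+n (length-filter-< h′)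
  ... | no _  | no _  | there h′      = length-filter-< h′

module Lattice (L : FiniteDistributiveLattice) where
  open FiniteDistributiveLattice L public
  open OrderTheory.IsLattice (LatticeProperties.∨-∧-isOrderTheoreticLattice lattice) public
    using (x≤x∨y; y≤x∨y; ∨-least; x∧y≤x; x∧y≤y; ∧-greatest; antisym)
  open SetoidMembership setoid using () renaming (_∈_ to _∈ˢ_)

  ≤-refl : ∀ {x} → x ≤ x
  ≤-refl = ≤-reflexive refl

  ≈⇒≥ : ∀ {x y} → x ≈ y → y ≤ x
  ≈⇒≥ x≈y = ≤-reflexive (sym x≈y)

  ji-resp : JoinIrreducible Respects _≈_
  ji-resp x≈y (x≉0 , irr) =
    (λ y≈0 → x≉0 (trans x≈y y≈0)) ,
    λ a b a∨b≈y → Sum.map (λ e → trans e x≈y) (λ e → trans e x≈y) (irr a b (trans a∨b≈y (sym x≈y)))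

  ji-prime : ∀ {j} → JoinIrreducible j → ∀ {x y} → j ≤ x ∨ y → j ≤ x ⊎ j ≤ y
  ji-prime (_ , irr) {x} {y} j≤x∨y =
    Sum.map sym sym (irr _ _ (sym (trans j≤x∨y (∧-distribˡ-∨ _ x y))))

  ji-≰0 : ∀ {j} → JoinIrreducible j → ¬ j ≤ 0#
  ji-≰0 (j≉0 , _) j≤0 = j≉0 (antisym j≤0 (minimum _))

  ≤⋁ : ∀ {x xs} → x ∈ˢ xs → x ≤ ⋁ xs
  ≤⋁ (here x≈y)   = ≤-trans (≤-reflexive x≈y) (x≤x∨y _ _)
  ≤⋁ (there x∈xs) = ≤-trans (≤⋁ x∈xs) (y≤x∨y _ _)

  ⋁-least : ∀ {xs y} → All (_≤ y) xs → ⋁ xs ≤ y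
  ⋁-least []         = minimum _
  ⋁-least (x≤y ∷ ps) = ∨-least x≤y (⋁-least ps)

  ⋁-prime : ∀ {j} → JoinIrreducible j → ∀ xs → j ≤ ⋁ xs → Any (j ≤_) xs
  ⋁-prime ji []       j≤0 = contradiction j≤0 (ji-≰0 ji)
  ⋁-prime ji (x ∷ xs) j≤  with ji-prime ji j≤
  ... | inj₁ j≤x  = here j≤x
  ... | inj₂ j≤xs = there (⋁-prime ji xs j≤xs)

  <-wellFounded′ : WellFounded _<_
  <-wellFounded′ x = build x (<-wellFounded (size x))
    where
    size : Carrier → ℕ
    size x = length (filter (_≤? x) elements)

    size-< : ∀ {x y} → x < y → size x ℕ.< size y
    size-< {x} {y} (x≤y , x≉y) =
      length-filter-< (_≤? x) (_≤? y) (λ z≤x → ≤-trans z≤x x≤y)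
        (Any.map (λ y≈z → ≈⇒≥ y≈z , λ z≤x → x≉y (antisym x≤y (≤-trans (≤-reflexive y≈z) z≤x)))
                 (complete y))

    build : ∀ x → Acc ℕ._<_ (size x) → Acc _<_ x
    build x (acc rs) = acc λ {y} y<x → build y (rs (size-< y<x))

  Reducible : Pred Carrier 0ℓ
  Reducible x = ∃[ a ] ∃[ b ] (a ∨ b ≈ x × a < x × b < x)

  cases : ∀ x → x ≈ 0# ⊎ JoinIrreducible x ⊎ Reducible x
  cases x with x ≟ 0#
  ... | yes x≈0 = inj₁ x≈0
  ... | no x≉0 with any? resp (λ a → any? (resp′ a) (λ b →
                      ((a ∨ b) ≟ x) ×-dec (¬? (a ≟ x) ×-dec ¬? (b ≟ x))))
    where
    Splits : Carrier → Carrier → Set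
    Splits a b = a ∨ b ≈ x × (¬ (a ≈ x) × ¬ (b ≈ x))

    resp′ : ∀ a → (Splits a) Respects _≈_
    resp′ a b≈b′ (eq , a≉x , b≉x) =
      trans (∨-congˡ (sym b≈b′)) eq , a≉x , λ b′≈x → b≉x (trans b≈b′ b′≈x)

    resp : (λ a → ∃[ b ] Splits a b) Respects _≈_
    resp a≈a′ (b , eq , a≉x , b≉x) =
      b , trans (∨-congʳ (sym a≈a′)) eq , (λ a′≈x → a≉x (trans a≈a′ a′≈x)) , b≉x
  ...   | yes (a , b , a∨b≈x , a≉x , b≉x) = inj₂ (inj₂ (a , b , a∨b≈x ,
            (≤-trans (x≤x∨y a b) (≤-reflexive a∨b≈x) , a≉x) ,
            (≤-trans (y≤x∨y a b) (≤-reflexive a∨b≈x) , b≉x)))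
  ...   | no ¬split = inj₂ (inj₁ (x≉0 , irr))
    where
    irr : ∀ a b → a ∨ b ≈ x → a ≈ x ⊎ b ≈ x
    irr a b a∨b≈x with a ≟ x | b ≟ x
    ... | yes a≈x | _       = inj₁ a≈x
    ... | no _    | yes b≈x = inj₂ b≈x
    ... | no a≉x  | no b≉x  = contradiction (a , b , a∨b≈x , a≉x , b≉x) ¬split

  ji-induction : (P : Pred Carrier 0ℓ) →
                 (∀ {x} → x ≈ 0# → P x) →
                 (∀ {x} → JoinIrreducible x → (∀ {y} → y < x → P y) → P x) →
                 (∀ {x a b} → a ∨ b ≈ x → P a → P b → P x) →
                 ∀ x → P x
  ji-induction P P0 Pji P∨ x = go x (<-wellFounded′ x)
    where
    go : ∀ x → Acc _<_ x → P x
    go x (acc rs) with cases x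
    ... | inj₁ x≈0 = P0 x≈0
    ... | inj₂ (inj₁ ji) = Pji ji (λ {y} y<x → go y (rs y<x))
    ... | inj₂ (inj₂ (a , b , eq , a<x , b<x)) = P∨ eq (go a (rs a<x)) (go b (rs b<x))

  ≤-by-ji : ∀ {x y} → (∀ {j} → JoinIrreducible j → j ≤ x → j ≤ y) → x ≤ y
  ≤-by-ji {x} {y} = ji-induction (λ x → (∀ {j} → JoinIrreducible j → j ≤ x → j ≤ y) → x ≤ y)
    (λ x≈0 _ → ≤-trans (≤-reflexive x≈0) (minimum y))
    (λ ji _ h → h ji ≤-refl)
    (λ {_} {a} {b} eq a-rec b-rec h → ≤-trans (≈⇒≥ eq)
      (∨-least (a-rec (λ ji j≤a → h ji (≤-trans j≤a (≤-trans (x≤x∨y a b) (≤-reflexive eq)))))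
               (b-rec (λ ji j≤b → h ji (≤-trans j≤b (≤-trans (y≤x∨y a b) (≤-reflexive eq)))))))
    x

  jiList : Σ[ js ∈ List J ] (∀ (j : J) → Any (λ k → proj₁ j ≈ proj₁ k) js)
  jiList = collect elements , λ (j , ji) → collect-complete (complete j) ji
    where
    collect : List Carrier → List J
    collect []       = []
    collect (x ∷ xs) with joinIrreducible? x
    ... | yes ji = (x , ji) ∷ collect xs
    ... | no _   = collect xs

    collect-complete : ∀ {j xs} → j ∈ˢ xs → JoinIrreducible j → Any (λ k → j ≈ proj₁ k) (collect xs)
    collect-complete {xs = x ∷ _} (here j≈x) ji with joinIrreducible? x
    ... | yes _  = here j≈x
    ... | no ¬ji = contradiction (ji-resp j≈x ji) ¬ji
    collect-complete {xs = x ∷ _} (there p) ji with joinIrreducible? x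
    ... | yes _ = there (collect-complete p ji)
    ... | no _  = collect-complete p ji

module CongruenceProperties (L : FiniteDistributiveLattice) (Φ : Congruence L) where
  open Lattice L
  open Congruence Φ
  open SetoidMembership setoid using () renaming (_∈_ to _∈ˢ_)

  ~-sym : ∀ {x y} → x ~ y → y ~ x
  ~-sym = Setoid.sym (record { isEquivalence = ~-isEquivalence })

  ~-refl : ∀ {x} → x ~ x
  ~-refl = ≈⇒~ refl

  N-resp : N Respects _≈_
  N-resp x≈x′ (y , (y≤x , y≉x) , x~y) =
    y , (≤-trans y≤x (≤-reflexive x≈x′) , λ y≈x′ → y≉x (trans y≈x′ (sym x≈x′))) ,
    ~-trans (≈⇒~ (sym x≈x′)) x~y

  private
    Part : Carrier → Pred Carrier 0ℓ
    Part x j = JoinIrreducible j × (j ≤ x × ¬ N j)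

    part? : ∀ x → U.Decidable (Part x)
    part? x j = joinIrreducible? j ×-dec ((j ≤? x) ×-dec ¬? (N? j))

    part-resp : ∀ x → Part x Respects _≈_
    part-resp x j≈k (ji , j≤x , j∉N) =
      ji-resp j≈k ji , ≤-trans (≈⇒≥ j≈k) j≤x , λ k∈N → j∉N (N-resp (sym j≈k) k∈N)

    part⁻ : ∀ {x j} → j ∈ˢ filter (part? x) elements → Part x j
    part⁻ {x} j∈ = proj₂ (SetoidMembershipₚ.∈-filter⁻ setoid (part? x) (part-resp x) {xs = elements} j∈)

  ¬N⇒≈ : ∀ {x y} → ¬ N x → y ≤ x → x ~ y → y ≈ x
  ¬N⇒≈ {x} {y} x∉N y≤x x~y = decidable-stable (y ≟ x) λ y≉x → x∉N (y , (y≤x , y≉x) , x~y)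

  ji≤−N : ∀ {j x} → JoinIrreducible j → ¬ N j → j ≤ x → j ≤ x −N
  ji≤−N {j} {x} ji j∉N j≤x =
    ≤⋁ {xs = filter (part? x) elements}
      (SetoidMembershipₚ.∈-filter⁺ setoid (part? x) (part-resp x) (complete j) (ji , j≤x , j∉N))

  -- A join-irreducible `j ≤ x` outside `N` satisfies `j ~ j ∧ y`; as `j` has nothing strictly
  -- smaller in its class, `j ∧ y ≈ j` and thus `j ≤ y`.
  −N-least : ∀ {x y} → y ~ x → x −N ≤ y
  −N-least {x} {y} y~x = ⋁-least {xs = filter (part? x) elements} (All.tabulateₛ setoid λ {j} j∈ →
    let ji , j≤x , j∉N = part⁻ {x} j∈
        j~j∧y = ~-trans (≈⇒~ j≤x) (∧-cong~ ~-refl (~-sym y~x))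
    in ≤-trans (≈⇒≥ (¬N⇒≈ j∉N (x∧y≤x j y) j~j∧y)) (x∧y≤y j y))

  −N≤ : ∀ {x} → x −N ≤ x
  −N≤ = −N-least ~-refl

  −N-below : ∀ {t x} → JoinIrreducible t → t ≤ x −N →
             ∃[ j ] (JoinIrreducible j × ¬ N j × j ≤ x × t ≤ j)
  −N-below {t} {x} ti t≤ with All.lookupAny
    (All.tabulateₛ setoid (part⁻ {x})) (⋁-prime ti (filter (part? x) elements) t≤)
  ... | (ji , j≤x , j∉N) , t≤j = _ , ji , j∉N , j≤x , t≤j

  ~-convex : ∀ {x y z} → x ≤ y → y ≤ z → x ~ z → y ~ z
  ~-convex {x} {y} {z} x≤y y≤z x~z =
    ~-trans (≈⇒~ (antisym (x≤x∨y y x) (∨-least ≤-refl x≤y)))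
      (~-trans (∨-cong~ ~-refl x~z) (≈⇒~ (antisym (∨-least y≤z ≤-refl) (y≤x∨y y z))))

  −N-mono-≤ : ∀ {x y} → x ≤ y → x −N ≤ y −N
  −N-mono-≤ x≤y = ≤-by-ji λ ti t≤ →
    let _ , ji , j∉N , j≤x , t≤j = −N-below ti t≤ in ≤-trans t≤j (ji≤−N ji j∉N (≤-trans j≤x x≤y))

  -- Only a join-irreducible `x` in `N` needs an argument: it is congruent to some `y < x`, which is
  -- congruent to `y −N` by induction, and classes are convex.
  −N-~ : ∀ x → x −N ~ x
  −N-~ = ji-induction (λ x → x −N ~ x)
    (λ x≈0 → ≈⇒~ (antisym −N≤ (≤-trans (≤-reflexive x≈0) (minimum _))))
    ji-case
    (λ {x} {a} {b} a∨b≈x a~ b~ → ~-convex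
       (∨-least (−N-mono-≤ (≤-trans (x≤x∨y a b) (≤-reflexive a∨b≈x)))
                (−N-mono-≤ (≤-trans (y≤x∨y a b) (≤-reflexive a∨b≈x))))
       −N≤ (~-trans (∨-cong~ a~ b~) (≈⇒~ a∨b≈x)))
    where
    ji-case : ∀ {x} → JoinIrreducible x → (∀ {y} → y < x → y −N ~ y) → x −N ~ x
    ji-case {x} ji rec with N? x
    ... | no x∉N = ≈⇒~ (antisym −N≤ (ji≤−N ji x∉N ≤-refl))
    ... | yes (y , y<x , x~y) =
      ~-convex (−N-mono-≤ (proj₁ y<x)) −N≤ (~-trans (rec y<x) (~-sym x~y))

  −N-cong : ∀ {x y} → x ~ y → x −N ≈ y −N
  −N-cong {x} {y} x~y =
    antisym (−N-least (~-trans (−N-~ y) (~-sym x~y))) (−N-least (~-trans (−N-~ x) x~y))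

-- Natural orders

module AntilexProperties
  (L : FiniteDistributiveLattice)
  {_⊏⁰_ : Rel (FiniteDistributiveLattice.J L) 0ℓ}
  (extension : FiniteDistributiveLattice.IsLinearExtension L _⊏⁰_) where

  open Lattice L
  open IsLinearExtension extension renaming (isStrictTotalOrder to isStrictTotalOrder⁰)
  private
    module O = IsStrictTotalOrder isStrictTotalOrder⁰

  infix 4 _⊏_

  _⊏_ : Rel Carrier 0ℓ
  _⊏_ = Antilex _⊏⁰_

  Agree : Carrier → Carrier → J → Set
  Agree x y (t , _) = (t ≤ x → t ≤ y) × (t ≤ y → t ≤ x)

  δ-<⁻ : ∀ s {x y} → δ s x ℕ.< δ s y → ¬ (proj₁ s ≤ x) × proj₁ s ≤ y
  δ-<⁻ (s , _) {x} {y} lt with s ≤? x | s ≤? y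
  δ-<⁻ (s , _) {x} {y} lt | no s≰x | yes s≤y = s≰x , s≤y
  δ-<⁻ (s , _) {x} {y} () | no _   | no _
  δ-<⁻ (s , _) {x} {y} (s≤s ()) | yes _  | yes _
  δ-<⁻ (s , _) {x} {y} ()       | yes _  | no _

  δ-<⁺ : ∀ s {x y} → ¬ (proj₁ s ≤ x) → proj₁ s ≤ y → δ s x ℕ.< δ s y
  δ-<⁺ (s , _) {x} {y} s≰x s≤y with s ≤? x | s ≤? y
  ... | no _    | yes _  = s≤s z≤n
  ... | no _    | no s≰y = contradiction s≤y s≰y
  ... | yes s≤x | _      = contradiction s≤x s≰x

  δ-≡⁻ : ∀ t {x y} → δ t x ≡ δ t y → Agree x y t
  δ-≡⁻ (t , _) {x} {y} eq with t ≤? x | t ≤? y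
  ... | yes t≤x | yes t≤y = (λ _ → t≤y) , (λ _ → t≤x)
  ... | no t≰x  | no t≰y  = (λ t≤x → contradiction t≤x t≰x) , (λ t≤y → contradiction t≤y t≰y)

  δ-≡⁺ : ∀ t {x y} → Agree x y t → δ t x ≡ δ t y
  δ-≡⁺ (t , _) {x} {y} (to , from) with t ≤? x | t ≤? y
  ... | yes _   | yes _   = ≡.refl
  ... | no _    | no _    = ≡.refl
  ... | yes t≤x | no t≰y  = contradiction (to t≤x) t≰y
  ... | no t≰x  | yes t≤y = contradiction (from t≤y) t≰x

  ⊏⁻ : ∀ {x y} → x ⊏ y →
       Σ[ s ∈ J ] (¬ (proj₁ s ≤ x) × proj₁ s ≤ y × (∀ t → s ⊏⁰ t → Agree x y t))
  ⊏⁻ (s , δs , δt) = s , proj₁ (δ-<⁻ s δs) , proj₂ (δ-<⁻ s δs) , λ t s⊏t → δ-≡⁻ t (δt t s⊏t)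

  ⊏⁺ : ∀ {x y} (s : J) → ¬ (proj₁ s ≤ x) → proj₁ s ≤ y → (∀ t → s ⊏⁰ t → Agree x y t) → x ⊏ y
  ⊏⁺ s s≰x s≤y agree = s , δ-<⁺ s s≰x s≤y , λ t s⊏t → δ-≡⁺ t (agree t s⊏t)

  ≤⇒⊏̸ : ∀ {x y} → x ≤ y → ¬ (y ⊏ x)
  ≤⇒⊏̸ x≤y y⊏x with ⊏⁻ y⊏x
  ... | _ , s≰y , s≤x , _ = s≰y (≤-trans s≤x x≤y)

  ⊏-irrefl : ∀ {x y} → x ≈ y → ¬ (x ⊏ y)
  ⊏-irrefl x≈y = ≤⇒⊏̸ (≈⇒≥ x≈y)

  ⊏-respʳ : ∀ {x y z} → y ≈ z → x ⊏ y → x ⊏ z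
  ⊏-respʳ y≈z x⊏y with ⊏⁻ x⊏y
  ... | s , s≰x , s≤y , agree = ⊏⁺ s s≰x (≤-trans s≤y (≤-reflexive y≈z)) λ t s⊏t →
    (λ t≤x → ≤-trans (proj₁ (agree t s⊏t) t≤x) (≤-reflexive y≈z)) ,
    (λ t≤z → proj₂ (agree t s⊏t) (≤-trans t≤z (≈⇒≥ y≈z)))

  ⊏-respˡ : ∀ {x y z} → y ≈ z → y ⊏ x → z ⊏ x
  ⊏-respˡ y≈z y⊏x with ⊏⁻ y⊏x
  ... | s , s≰y , s≤x , agree = ⊏⁺ s (λ s≤z → s≰y (≤-trans s≤z (≈⇒≥ y≈z))) s≤x λ t s⊏t →
    (λ t≤z → proj₁ (agree t s⊏t) (≤-trans t≤z (≈⇒≥ y≈z))) ,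
    (λ t≤x → ≤-trans (proj₂ (agree t s⊏t) t≤x) (≤-reflexive y≈z))

  ⊏-trans : ∀ {x y z} → x ⊏ y → y ⊏ z → x ⊏ z
  ⊏-trans x⊏y y⊏z with ⊏⁻ x⊏y | ⊏⁻ y⊏z
  ... | s , s≰x , s≤y , agree | s′ , s′≰y , s′≤z , agree′ with O.compare s s′
  ...   | tri< s⊏s′ _ _ = ⊏⁺ s′ (s′≰y ∘ proj₁ (agree s′ s⊏s′)) s′≤z λ t s′⊏t →
            let to , from = agree t (O.trans s⊏s′ s′⊏t) ; to′ , from′ = agree′ t s′⊏t
            in to′ ∘ to , from ∘ from′
  ...   | tri≈ _ s≈s′ _ = contradiction (≤-trans (≈⇒≥ s≈s′) s≤y) s′≰y
  ...   | tri> _ _ s′⊏s = ⊏⁺ s s≰x (proj₁ (agree′ s s′⊏s) s≤y) λ t s⊏t →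
            let to , from = agree t s⊏t ; to′ , from′ = agree′ t (O.trans s′⊏s s⊏t)
            in to′ ∘ to , from ∘ from′

  maximal : {P : Pred J 0ℓ} → U.Decidable P → ∀ js →
            All (¬_ ∘ P) js ⊎ ∃[ s ] (P s × All (λ t → s ⊏⁰ t → ¬ P t) js)
  maximal P? []       = inj₁ []
  maximal P? (j ∷ js) with P? j | maximal P? js
  ... | no ¬p | inj₁ none          = inj₁ (¬p ∷ none)
  ... | no ¬p | inj₂ (s , p , max) = inj₂ (s , p , (λ _ → ¬p) ∷ max)
  ... | yes p | inj₁ none          = inj₂ (j , p , (λ j⊏j → contradiction j⊏j (O.irrefl refl)) ∷
                                              All.map (λ ¬p _ → ¬p) none)
  ... | yes p | inj₂ (s , p′ , max) with O.compare s j
  ...   | tri< s⊏j _ _ = inj₂ (j , p , (λ j⊏j → contradiction j⊏j (O.irrefl refl)) ∷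
                                 All.map (λ h j⊏t → h (O.trans s⊏j j⊏t)) max)
  ...   | tri≈ s⊏̸j _ _ = inj₂ (s , p′ , (λ s⊏j → contradiction s⊏j s⊏̸j) ∷ max)
  ...   | tri> s⊏̸j _ _ = inj₂ (s , p′ , (λ s⊏j → contradiction s⊏j s⊏̸j) ∷ max)

  -- The last join-irreducible that lies below exactly one of the two decides. If there is none,
  -- both have the same join-irreducibles below them and are equal.
  ⊏-total : ∀ {x y} → ¬ (x ≈ y) → x ⊏ y ⊎ y ⊏ x
  ⊏-total {x} {y} x≉y = go (maximal (¬? ∘ agree?) (proj₁ jiList))
    where
    agree? : U.Decidable (Agree x y)
    agree? (t , _) = ((t ≤? x) →-dec (t ≤? y)) ×-dec ((t ≤? y) →-dec (t ≤? x))

    agree-resp : ∀ {t t′} → proj₁ t ≈ proj₁ t′ → Agree x y t′ → Agree x y t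
    agree-resp t≈t′ (to , from) =
      (λ t≤x → ≤-trans (≤-reflexive t≈t′) (to (≤-trans (≈⇒≥ t≈t′) t≤x))) ,
      (λ t≤y → ≤-trans (≤-reflexive t≈t′) (from (≤-trans (≈⇒≥ t≈t′) t≤y)))

    go : All (λ t → ¬ ¬ Agree x y t) (proj₁ jiList) ⊎
         ∃[ s ] (¬ Agree x y s × All (λ t → s ⊏⁰ t → ¬ ¬ Agree x y t) (proj₁ jiList)) →
         x ⊏ y ⊎ y ⊏ x
    go (inj₁ all) = contradiction
      (antisym (≤-by-ji λ {j} ji → proj₁ (agree (j , ji))) (≤-by-ji λ {j} ji → proj₂ (agree (j , ji)))) x≉y
      where
      agree : ∀ t → Agree x y t
      agree t with All.lookupAny all (proj₂ jiList t)
      ... | ¬¬agree , t≈t′ =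
        agree-resp {t} {t′} t≈t′ (decidable-stable (agree? t′) ¬¬agree)
        where t′ = Any.lookup (proj₂ jiList t)
    go (inj₂ (s , disagree , max)) = side (proj₁ s ≤? x) (proj₁ s ≤? y)
      where
      agree : ∀ t → s ⊏⁰ t → Agree x y t
      agree t s⊏t with All.lookupAny max (proj₂ jiList t)
      ... | ¬¬agree , t≈t′ =
        agree-resp {t} {t′} t≈t′
          (decidable-stable (agree? t′) (¬¬agree (proj₁ O.<-resp-≈ t≈t′ s⊏t)))
        where t′ = Any.lookup (proj₂ jiList t)

      side : Dec (proj₁ s ≤ x) → Dec (proj₁ s ≤ y) → x ⊏ y ⊎ y ⊏ x
      side (no s≰x)  (yes s≤y) = inj₁ (⊏⁺ s s≰x s≤y agree)
      side (yes s≤x) (no s≰y)  = inj₂ (⊏⁺ s s≰y s≤x λ t s⊏t →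
                                   let to , from = agree t s⊏t in from , to)
      side (yes s≤x) (yes s≤y) = contradiction ((λ _ → s≤y) , (λ _ → s≤x)) disagree
      side (no s≰x)  (no s≰y)  = contradiction
        ((λ s≤x → contradiction s≤x s≰x) , (λ s≤y → contradiction s≤y s≰y)) disagree

  ⊏-isStrictTotalOrder : IsStrictTotalOrder _≈_ _⊏_
  ⊏-isStrictTotalOrder = record
    { isStrictPartialOrder = record
      { isEquivalence = isEquivalence
      ; irrefl        = ⊏-irrefl
      ; trans         = ⊏-trans
      ; <-resp-≈      = ⊏-respʳ , ⊏-respˡ
      }
    ; compare = compare
    }
    where
    compare : Trichotomous _≈_ _⊏_
    compare x y with x ≟ y
    ... | yes x≈y = tri≈ (⊏-irrefl x≈y) x≈y (⊏-irrefl (sym x≈y))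
    ... | no x≉y with ⊏-total x≉y
    ...   | inj₁ x⊏y = tri< x⊏y x≉y (⊏-irrefl refl ∘ ⊏-trans x⊏y)
    ...   | inj₂ y⊏x = tri> (⊏-irrefl refl ∘ ⊏-trans y⊏x) x≉y y⊏x

-- A homomorphism f that has a lower adjoint e on the join-irreducibles, together
-- with the map m to the least elements of the classes of its kernel.
module Transfer
  (M K : FiniteDistributiveLattice)
  {_⊏⁰ᴹ_ : Rel (FiniteDistributiveLattice.J M) 0ℓ}
  (extensionᴹ : FiniteDistributiveLattice.IsLinearExtension M _⊏⁰ᴹ_)
  {_⊏⁰ᴷ_ : Rel (FiniteDistributiveLattice.J K) 0ℓ}
  (extensionᴷ : FiniteDistributiveLattice.IsLinearExtension K _⊏⁰ᴷ_) where

  private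
    module M where
      open Lattice M public
      open AntilexProperties M extensionᴹ public
    module K where
      open Lattice K public
      open AntilexProperties K extensionᴷ public
    module Oᴹ = IsStrictTotalOrder (M.IsLinearExtension.isStrictTotalOrder extensionᴹ)
    module Oᴷ = IsStrictTotalOrder (K.IsLinearExtension.isStrictTotalOrder extensionᴷ)

  module _
    (f : M.Carrier → K.Carrier)
    (f-∧ : ∀ x y → f (x M.∧ y) K.≈ f x K.∧ f y)
    (e : K.J → M.J)
    (adjoint⁺ : ∀ s {z} → proj₁ s K.≤ f z → proj₁ (e s) M.≤ z)
    (adjoint⁻ : ∀ s {z} → proj₁ (e s) M.≤ z → proj₁ s K.≤ f z)
    (e-mono : ∀ {s t} → s ⊏⁰ᴷ t → e s ⊏⁰ᴹ e t)
    (e-cong : ∀ {s t} → proj₁ s K.≈ proj₁ t → proj₁ (e s) M.≈ proj₁ (e t))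
    (m : M.Carrier → M.Carrier)
    (f-m : ∀ x → f (m x) K.≈ f x)
    (m-least : ∀ {x z} → f z K.≈ f x → m x M.≤ z) where

    e-cancel : ∀ {s t} → e s ⊏⁰ᴹ e t → s ⊏⁰ᴷ t
    e-cancel {s} {t} es⊏et with Oᴷ.compare s t
    ... | tri< s⊏t _ _ = s⊏t
    ... | tri≈ _ s≈t _ = contradiction es⊏et (Oᴹ.irrefl (e-cong s≈t))
    ... | tri> _ _ t⊏s = contradiction es⊏et (Oᴹ.asym (e-mono t⊏s))

    -- The least element of a class lies below the join of the e t, t ≤ f x.
    m-below : ∀ {u x} → M.JoinIrreducible u → u M.≤ m x →
              ∃[ t ] (proj₁ t K.≤ f x × u M.≤ proj₁ (e t))
    m-below {u} {x} ui u≤mx =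
      let _ , y∈map , u≤y = find (M.⋁-prime ui (map (proj₁ ∘ e) ts) u≤z)
          t , t∈ts , y≡et = ∈-map⁻ (proj₁ ∘ e) y∈map
      in t , proj₂ (∈-filter⁻ t≤fx? {xs = proj₁ K.jiList} t∈ts) , ≡.subst (u M.≤_) y≡et u≤y
      where
      t≤fx? : U.Decidable (λ (t : K.J) → proj₁ t K.≤ f x)
      t≤fx? t = proj₁ t K.≤? f x

      ts : List K.J
      ts = filter t≤fx? (proj₁ K.jiList)

      z : M.Carrier
      z = M.⋁ (map (proj₁ ∘ e) ts)

      fx≤fz : f x K.≤ f z
      fx≤fz = K.≤-by-ji λ {j} ji j≤fx →
        let k , k∈js , j≈k = find (proj₂ K.jiList (j , ji))
            k∈ts = ∈-filter⁺ t≤fx? k∈js (K.≤-trans (K.≈⇒≥ j≈k) j≤fx)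
            ek∈map = ∈-map⁺ (proj₁ ∘ e) k∈ts
        in K.≤-trans (K.≤-reflexive j≈k) (adjoint⁻ k (M.≤⋁ (Any.map M.reflexive ek∈map)))

      u≤z : u M.≤ z
      u≤z = M.≤-trans u≤mx (M.≤-trans
        (m-least (K.trans (f-∧ x z) (K.sym fx≤fz))) (M.x∧y≤y x z))

    -- If `s` decides `f x ⊏ f y`, then `e s` decides `m x ⊏ m y`. A later `u ≤ m x` lies below some
    -- `e t` with `t ≤ f x`; then `e s` precedes `e t`, so `s` precedes `t`, the agreement after `s`
    -- gives `t ≤ f y`, and `u ≤ e t ≤ m y`. The other half is symmetric.
    transfer : ∀ {x y} → f x K.⊏ f y → m x M.⊏ m y
    transfer {x} {y} fx⊏fy with K.⊏⁻ fx⊏fy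
    ... | s , s≰fx , s≤fy , agree = M.⊏⁺ (e s)
      (λ es≤mx → s≰fx (K.≤-trans (adjoint⁻ s es≤mx) (K.≤-reflexive (f-m x))))
      (up s≤fy)
      (λ u es⊏u → half (λ t s⊏t → proj₁ (agree t s⊏t)) u es⊏u ,
                  half (λ t s⊏t → proj₂ (agree t s⊏t)) u es⊏u)
      where
      up : ∀ {t x} → proj₁ t K.≤ f x → proj₁ (e t) M.≤ m x
      up {t} {x} t≤fx = adjoint⁺ t (K.≤-trans t≤fx (K.≈⇒≥ (f-m x)))

      half : ∀ {x y} → (∀ t → s ⊏⁰ᴷ t → proj₁ t K.≤ f x → proj₁ t K.≤ f y) →
             ∀ u → e s ⊏⁰ᴹ u → proj₁ u M.≤ m x → proj₁ u M.≤ m y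
      half {x} {y} h (u , ui) es⊏u u≤mx with m-below {u} {x} ui u≤mx
      ... | t , t≤fx , u≤et = M.≤-trans u≤et (up (h t (e-cancel es⊏et) t≤fx))
        where
        es⊏et : e s ⊏⁰ᴹ e t
        es⊏et with u M.≟ proj₁ (e t)
        ... | yes u≈et = proj₁ Oᴹ.<-resp-≈ u≈et es⊏u
        ... | no u≉et  = Oᴹ.trans es⊏u (M.IsLinearExtension.extends extensionᴹ (u≤et , u≉et))

    reflect : ∀ {x y} → m x M.⊏ m y → f x K.⊏ f y
    reflect {x} {y} mx⊏my with IsStrictTotalOrder.compare K.⊏-isStrictTotalOrder (f x) (f y)
    ... | tri< fx⊏fy _ _ = fx⊏fy
    ... | tri≈ _ fx≈fy _ = contradiction mx⊏my
            (M.≤⇒⊏̸ (m-least (K.trans (f-m x) fx≈fy)))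
    ... | tri> _ _ fy⊏fx = contradiction mx⊏my
            (IsStrictTotalOrder.asym M.⊏-isStrictTotalOrder (transfer fy⊏fx))

-- Puts lattices, whose natural order is given strictly, and quotients, whose order is given
-- reflexively on classes, on the same footing.
record Natural (K : OrderedLattice) : Set₁ where
  open OrderedLattice K
  field
    _⊏⁰_      : Rel J 0ℓ
    extension : IsLinearExtension _⊏⁰_
    ⊑⁻        : ∀ {x y} → x ⊑ y → Antilex _⊏⁰_ x y ⊎ x ≈ y
    ⊑⁺        : ∀ {x y} → Antilex _⊏⁰_ x y ⊎ x ≈ y → x ⊑ y

natural : (L : NaturallyOrderedLattice) → Natural (NaturallyOrderedLattice.orderedLattice L)
natural L = record
  { extension = proj₁ (proj₂ isNatural)
  ; ⊑⁻        = Sum.map₁ (Equivalence.to (proj₂ (proj₂ isNatural) _ _))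
  ; ⊑⁺        = Sum.map₁ (Equivalence.from (proj₂ (proj₂ isNatural) _ _))
  }
  where open NaturallyOrderedLattice L

module QuotientOrder (L : NaturallyOrderedLattice)
                     (Φ : Congruence (NaturallyOrderedLattice.finiteDistributiveLattice L)) where
  private
    module L where
      open Lattice (NaturallyOrderedLattice.finiteDistributiveLattice L) public
      open Natural (natural L) public
      open AntilexProperties (NaturallyOrderedLattice.finiteDistributiveLattice L) extension public
      open OrderedLattice (NaturallyOrderedLattice.orderedLattice L) public using (_⊑_)
    module Q = Lattice (Congruence.quotient Φ)
  open L using (_≈_; _≤_; _∧_; _⊑_)
  open Congruence Φ
  open CongruenceProperties (NaturallyOrderedLattice.finiteDistributiveLattice L) Φ
  private
    module O⁰ = IsStrictTotalOrder (L.IsLinearExtension.isStrictTotalOrder L.extension)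
    module O = IsStrictTotalOrder L.⊏-isStrictTotalOrder

  ⊑-total : ∀ x y → x ⊑ y ⊎ y ⊑ x
  ⊑-total x y with O.compare x y
  ... | tri< x⊏y _ _ = inj₁ (L.⊑⁺ (inj₁ x⊏y))
  ... | tri≈ _ x≈y _ = inj₁ (L.⊑⁺ (inj₂ x≈y))
  ... | tri> _ _ y⊏x = inj₂ (L.⊑⁺ (inj₁ y⊏x))

  −N-⊑ : ∀ {x y} → x −N ⊑ y −N → ∀ {a b} → a ~ x → b ~ y → a −N ⊑ b −N
  −N-⊑ mx⊑my a~x b~y with L.⊑⁻ mx⊑my
  ... | inj₁ mx⊏my = L.⊑⁺ (inj₁ (L.⊏-respˡ (L.sym (−N-cong a~x)) (L.⊏-respʳ (L.sym (−N-cong b~y)) mx⊏my)))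
  ... | inj₂ mx≈my = L.⊑⁺ (inj₂ (L.trans (−N-cong a~x) (L.trans mx≈my (L.sym (−N-cong b~y)))))

  positiveCongruence : PositiveCongruence L
  positiveCongruence = record
    { congruence = Φ
    ; positive   = λ x y _ → Sum.map (λ le {_} {_} a~x b~y → −N-⊑ le a~x b~y)
                                     (λ ge {_} {_} a~x b~y → −N-⊑ ge b~y a~x)
                                     (⊑-total (x −N) (y −N))
    }

  -- The lower adjoint of the quotient map. If `a ∨ b` is the least element of a join-irreducible
  -- class, then `a` or `b` lies in that class and so cannot be smaller.
  least : Q.J → L.J
  least (x , x≁0 , irr) = x −N ,
    (λ m≈0 → x≁0 (~-trans (~-sym (−N-~ x)) (≈⇒~ m≈0))) ,
    λ a b a∨b≈m → Sum.map (reach (L.≤-trans (L.x≤x∨y a b) (L.≤-reflexive a∨b≈m)))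
                          (reach (L.≤-trans (L.y≤x∨y a b) (L.≤-reflexive a∨b≈m)))
                          (irr a b (~-trans (≈⇒~ a∨b≈m) (−N-~ x)))
    where
    reach : ∀ {a} → a ≤ x −N → a ~ x → a ≈ x −N
    reach a≤m a~x = L.antisym a≤m (−N-least a~x)

  _⊏⁰_ : Rel Q.J 0ℓ
  s ⊏⁰ t = least s L.⊏⁰ least t

  least-adjoint⁺ : ∀ {x z} → x Q.≤ z → x −N ≤ z
  least-adjoint⁺ x~x∧z = L.≤-trans (−N-least (~-sym x~x∧z)) (L.x∧y≤y _ _)

  least-adjoint⁻ : ∀ {x z} → x −N ≤ z → x Q.≤ z
  least-adjoint⁻ m≤z =
    ~-trans (~-sym (−N-~ _)) (~-trans (≈⇒~ m≤z) (∧-cong~ (−N-~ _) ~-refl))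

  least-cancel : ∀ {x y} → x −N ≈ y −N → x ~ y
  least-cancel m≈m = ~-trans (~-sym (−N-~ _)) (~-trans (≈⇒~ m≈m) (−N-~ _))

  extension : Q.IsLinearExtension _⊏⁰_
  extension = record
    { isStrictTotalOrder = record
      { isStrictPartialOrder = record
        { isEquivalence = On.isEquivalence proj₁ ~-isEquivalence
        ; irrefl        = λ s~t → O⁰.irrefl (−N-cong s~t)
        ; trans         = O⁰.trans
        ; <-resp-≈      = (λ s~t → proj₁ O⁰.<-resp-≈ (−N-cong s~t))
                        , (λ s~t → proj₂ O⁰.<-resp-≈ (−N-cong s~t))
        }
      ; compare = compare
      }
    ; extends = λ {s} {t} (s≤t , s≁t) → L.IsLinearExtension.extends L.extension
        ( least-adjoint⁺ (~-trans s≤t (∧-cong~ ~-refl (~-sym (−N-~ _))))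
        , λ m≈m → s≁t (least-cancel m≈m))
    }
    where
    compare : Trichotomous (Q._≈_ on proj₁) _⊏⁰_
    compare s@(x , _) t@(y , _) = map-≈ (O⁰.compare (least s) (least t))
      where
      map-≈ : Tri (s ⊏⁰ t) (x −N ≈ y −N) (t ⊏⁰ s) → Tri (s ⊏⁰ t) (x ~ y) (t ⊏⁰ s)
      map-≈ (tri< a ¬b ¬c) = tri< a (λ x~y → ¬b (−N-cong x~y)) ¬c
      map-≈ (tri≈ ¬a b ¬c) = tri≈ ¬a (least-cancel b) ¬c
      map-≈ (tri> ¬a ¬b c) = tri> ¬a (λ x~y → ¬b (−N-cong x~y)) c

  open Transfer (NaturallyOrderedLattice.finiteDistributiveLattice L) quotient L.extension extension

  quotientNatural : Natural (L / positiveCongruence)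
  quotientNatural = record
    { _⊏⁰_      = _⊏⁰_
    ; extension = extension
    ; ⊑⁻        = λ {x} {y} x⊑y → Sum.map ⊏-reflect least-cancel (L.⊑⁻ (x⊑y {x} {y} ~-refl ~-refl))
    ; ⊑⁺        = λ p → −N-⊑ (L.⊑⁺ (Sum.map ⊏-transfer −N-cong p))
    }
    where
    ⊏-transfer : ∀ {x y} → Q.Antilex _⊏⁰_ x y → x −N L.⊏ y −N
    ⊏-transfer = transfer id (λ _ _ → ~-refl) least (λ _ → least-adjoint⁺) (λ _ → least-adjoint⁻)
      id −N-cong _−N −N-~ −N-least

    ⊏-reflect : ∀ {x y} → x −N L.⊏ y −N → Q.Antilex _⊏⁰_ x y
    ⊏-reflect = reflect id (λ _ _ → ~-refl) least (λ _ → least-adjoint⁺) (λ _ → least-adjoint⁻)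
      id −N-cong _−N −N-~ −N-least

-- Free bounded distributive lattices

private
  variable
    n : ℕ

-- Terms will be identified when they agree under all Boolean valuations. This yields the free
-- lattice because prime filters separate the elements of a distributive lattice.
data Term (n : ℕ) : Set where
  var     : Fin n → Term n
  𝟘 𝟙     : Term n
  _⊔_ _⊓_ : (x y : Term n) → Term n

eval : Vec Bool n → Term n → Bool
eval a (var i) = Vec.lookup a i
eval a 𝟘       = false
eval a 𝟙       = true
eval a (x ⊔ y) = eval a x || eval a y
eval a (x ⊓ y) = eval a x && eval a y

infix 4 _⊢_

_⊢_ : Vec Bool n → Term n → Set
a ⊢ x = eval a x ≡ true

⊢⊔⁻ : (a : Vec Bool n) (x y : Term n) → a ⊢ x ⊔ y → a ⊢ x ⊎ a ⊢ y
⊢⊔⁻ a x y h with eval a x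
... | true  = inj₁ ≡.refl
... | false = inj₂ h

⊢⊔⁺ˡ : (a : Vec Bool n) (x y : Term n) → a ⊢ x → a ⊢ x ⊔ y
⊢⊔⁺ˡ a x y h rewrite h = ≡.refl

⊢⊔⁺ʳ : (a : Vec Bool n) (x y : Term n) → a ⊢ y → a ⊢ x ⊔ y
⊢⊔⁺ʳ a x y h rewrite h = Bool.∨-zeroʳ (eval a x)

⊢⊓⁻ : (a : Vec Bool n) (x y : Term n) → a ⊢ x ⊓ y → a ⊢ x × a ⊢ y
⊢⊓⁻ a x y h with eval a x | eval a y
... | true | true = ≡.refl , ≡.refl

⊢⊓⁺ : (a : Vec Bool n) (x y : Term n) → a ⊢ x → a ⊢ y → a ⊢ x ⊓ y
⊢⊓⁺ a x y p q rewrite p | q = ≡.refl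

⊢-mono : {a b : Vec Bool n} → (∀ i → a ⊢ var i → b ⊢ var i) → ∀ x → a ⊢ x → b ⊢ x
⊢-mono le (var i) h = le i h
⊢-mono le 𝟙       h = ≡.refl
⊢-mono {a = a} {b} le (x ⊔ y) h =
  [ ⊢⊔⁺ˡ b x y ∘ ⊢-mono le x , ⊢⊔⁺ʳ b x y ∘ ⊢-mono le y ] (⊢⊔⁻ a x y h)
⊢-mono {a = a} {b} le (x ⊓ y) h =
  let p , q = ⊢⊓⁻ a x y h in ⊢⊓⁺ b x y (⊢-mono le x p) (⊢-mono le y q)

≡-by-true : ∀ {p q : Bool} → (p ≡ true → q ≡ true) → (q ≡ true → p ≡ true) → p ≡ q
≡-by-true {true}  {_}     to from = ≡.sym (to ≡.refl)
≡-by-true {false} {false} to from = ≡.refl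
≡-by-true {false} {true}  to from = from ≡.refl

meet : List (Fin n) → Term n
meet = foldr (λ i x → var i ⊓ x) 𝟙

join : List (Term n) → Term n
join = foldr _⊔_ 𝟘

⊢meet⁺ : (a : Vec Bool n) (is : List (Fin n)) → (∀ {i} → i ∈ is → a ⊢ var i) → a ⊢ meet is
⊢meet⁺ a []       h = ≡.refl
⊢meet⁺ a (i ∷ is) h = ⊢⊓⁺ a (var i) (meet is) (h (here ≡.refl)) (⊢meet⁺ a is (h ∘ there))

⊢meet⁻ : (a : Vec Bool n) (is : List (Fin n)) → a ⊢ meet is → ∀ {i} → i ∈ is → a ⊢ var i
⊢meet⁻ a (i ∷ is) h (here ≡.refl) = proj₁ (⊢⊓⁻ a (var i) (meet is) h)
⊢meet⁻ a (i ∷ is) h (there i∈)    = ⊢meet⁻ a is (proj₂ (⊢⊓⁻ a (var i) (meet is) h)) i∈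

⊢join⁺ : (a : Vec Bool n) {xs : List (Term n)} {x : Term n} → x ∈ xs → a ⊢ x → a ⊢ join xs
⊢join⁺ a {x ∷ xs} (here ≡.refl) h = ⊢⊔⁺ˡ a x (join xs) h
⊢join⁺ a {x ∷ xs} (there x∈)    h = ⊢⊔⁺ʳ a x (join xs) (⊢join⁺ a x∈ h)

⊢join⁻ : (a : Vec Bool n) (xs : List (Term n)) → a ⊢ join xs → ∃[ x ] (x ∈ xs × a ⊢ x)
⊢join⁻ a (x ∷ xs) h with ⊢⊔⁻ a x (join xs) h
... | inj₁ p = x , here ≡.refl , p
... | inj₂ q = let y , y∈ , p = ⊢join⁻ a xs q in y , there y∈ , p

on? : (a : Vec Bool n) → U.Decidable (λ i → a ⊢ var i)
on? a i = Vec.lookup a i Bool.≟ true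

conj : Vec Bool n → Term n
conj {n} a = meet (filter (on? a) (allFin n))

⊢conj⁺ : {a b : Vec Bool n} → (∀ i → a ⊢ var i → b ⊢ var i) → b ⊢ conj a
⊢conj⁺ {n} {a} {b} le = ⊢meet⁺ b _ λ {i} i∈ → le i (proj₂ (∈-filter⁻ (on? a) {xs = allFin n} i∈))

⊢conj⁻ : {a b : Vec Bool n} → b ⊢ conj a → ∀ i → a ⊢ var i → b ⊢ var i
⊢conj⁻ {n} {a} {b} h i ai = ⊢meet⁻ b _ h (∈-filter⁺ (on? a) (∈-allFin i) ai)

valuations : ∀ n → Listed (Vec Bool n)
valuations zero    = [] ∷ [] , λ { [] → here ≡.refl }
valuations (suc n) =
  cartesianProductWith _∷_ bools (proj₁ (valuations n)) ,
  λ { (b ∷ a) → ∈-cartesianProductWith⁺ _∷_ (b∈ b) (proj₂ (valuations n) a) }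
  where
  bools : List Bool
  bools = true ∷ false ∷ []

  b∈ : ∀ b → b ∈ bools
  b∈ true  = here ≡.refl
  b∈ false = there (here ≡.refl)

⊢? : (x : Term n) → U.Decidable (_⊢ x)
⊢? x a = eval a x Bool.≟ true

dnf : List (Vec Bool n) → Term n
dnf as = join (map conj as)

models : Term n → List (Vec Bool n)
models {n} x = filter (⊢? x) (proj₁ (valuations n))

-- Terms are monotone, so this disjunctive normal form gets by without negated generators.
eval-dnf : (x : Term n) (a : Vec Bool n) → eval a x ≡ eval a (dnf (models x))
eval-dnf {n} x a = ≡-by-true
  (λ h → ⊢join⁺ a (∈-map⁺ conj (∈-filter⁺ (⊢? x) (proj₂ (valuations n) a) h)) (⊢conj⁺ {a = a} λ _ → id))
  (λ h → let y , y∈ , ay = ⊢join⁻ a (map conj (models x)) h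
             b , b∈ , y≡ = ∈-map⁻ conj y∈
             bx = proj₂ (∈-filter⁻ (⊢? x) {xs = proj₁ (valuations n)} b∈)
         in ⊢-mono (⊢conj⁻ {a = b} (≡.subst (a ⊢_) y≡ ay)) x bx)

sublists : {A : Set} → List A → List (List A)
sublists []       = [] ∷ []
sublists (x ∷ xs) = sublists xs ++ map (x ∷_) (sublists xs)

filter∈sublists : {A : Set} {P : Pred A 0ℓ} (P? : U.Decidable P) (xs : List A) →
                  filter P? xs ∈ sublists xs
filter∈sublists P? []       = here ≡.refl
filter∈sublists P? (x ∷ xs) with does (P? x)
... | true  = ∈-++⁺ʳ (sublists xs) (∈-map⁺ (x ∷_) (filter∈sublists P? xs))
... | false = ∈-++⁺ˡ (filter∈sublists P? xs)

-- A record, so that x and y can be inferred from x ≋ y.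
record _≋_ (x y : Term n) : Set where
  constructor pointwise
  field
    agree : ∀ a → eval a x ≡ eval a y

open _≋_

freeLattice : ℕ → DistributiveLattice 0ℓ 0ℓ
freeLattice n = record
  { Carrier = Term n
  ; _≈_     = _≋_
  ; _∨_     = _⊔_
  ; _∧_     = _⊓_
  ; isDistributiveLattice = record
    { isLattice = record
      { isEquivalence = record
        { refl  = pointwise λ _ → ≡.refl
        ; sym   = λ e → pointwise λ a → ≡.sym (agree e a)
        ; trans = λ e e′ → pointwise λ a → ≡.trans (agree e a) (agree e′ a)
        }
      ; ∨-comm     = λ x y → pointwise λ a → Bool.∨-comm (eval a x) (eval a y)
      ; ∨-assoc    = λ x y z → pointwise λ a → Bool.∨-assoc (eval a x) (eval a y) (eval a z)
      ; ∨-cong     = λ e e′ → pointwise λ a → ≡.cong₂ _||_ (agree e a) (agree e′ a)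
      ; ∧-comm     = λ x y → pointwise λ a → Bool.∧-comm (eval a x) (eval a y)
      ; ∧-assoc    = λ x y z → pointwise λ a → Bool.∧-assoc (eval a x) (eval a y) (eval a z)
      ; ∧-cong     = λ e e′ → pointwise λ a → ≡.cong₂ _&&_ (agree e a) (agree e′ a)
      ; absorptive = (λ x y → pointwise λ a → proj₁ Bool.∨-∧-absorptive (eval a x) (eval a y))
                   , (λ x y → pointwise λ a → proj₂ Bool.∨-∧-absorptive (eval a x) (eval a y))
      }
    ; ∨-distrib-∧ =
        (λ x y z → pointwise λ a → proj₁ Bool.∨-distrib-∧ (eval a x) (eval a y) (eval a z))
      , (λ x y z → pointwise λ a → proj₂ Bool.∨-distrib-∧ (eval a x) (eval a y) (eval a z))
    ; ∧-distrib-∨ =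
        (λ x y z → pointwise λ a → proj₁ Bool.∧-distrib-∨ (eval a x) (eval a y) (eval a z))
      , (λ x y z → pointwise λ a → proj₂ Bool.∧-distrib-∨ (eval a x) (eval a y) (eval a z))
    }
  }

free : ℕ → FiniteDistributiveLattice
free n = record
  { distributiveLattice = freeLattice n
  ; 0#       = 𝟘
  ; 1#       = 𝟙
  ; minimum  = λ x → pointwise λ a → ≡.refl
  ; maximum  = λ x → pointwise λ a → ≡.sym (Bool.∧-identityʳ (eval a x))
  ; _≟_      = λ x y → map′
      (λ all → pointwise λ a → All.lookup all (proj₂ (valuations n) a))
      (λ e → All.universal (agree e) (proj₁ (valuations n)))
      (All.all? (λ a → eval a x Bool.≟ eval a y) (proj₁ (valuations n)))
  -- Every term equals the normal form of its list of models, a sublist of all valuations; the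
  -- remaining sublists merely repeat elements.
  ; elements = map dnf (sublists (proj₁ (valuations n)))
  ; complete = λ x → Any.map (λ { ≡.refl → pointwise (eval-dnf x) })
      (∈-map⁺ dnf (filter∈sublists (⊢? x) (proj₁ (valuations n))))
  }

least? : {P : Pred (Fin n) 0ℓ} → U.Decidable P →
         (∀ i → ¬ P i) ⊎ ∃[ i ] (P i × (∀ {i′} → i′ <ᶠ i → ¬ P i′))
least? {zero}  P? = inj₁ λ ()
least? {suc n} P? with P? zero | least? (P? ∘ suc)
... | yes p | _                  = inj₂ (zero , p , λ ())
... | no ¬p | inj₁ none          = inj₁ λ { zero → ¬p ; (suc i) → none i }
... | no ¬p | inj₂ (i , p , min) =
  inj₂ (suc i , p , λ { {zero} _ → ¬p ; {suc i′} i′<i → min (s<s⁻¹ i′<i) })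

-- In the free lattice the join-irreducibles are the meets of generators.  They
-- are ordered lexicographically by the sets of generators above them.
module FreeOrder (n : ℕ) where
  open Lattice (free n)

  ≤⁺ : ∀ {x y} → (∀ a → a ⊢ x → a ⊢ y) → x ≤ y
  ≤⁺ {x} {y} h = pointwise λ a → ≡-by-true (λ p → ⊢⊓⁺ a x y p (h a p)) (λ p → proj₁ (⊢⊓⁻ a x y p))

  ≤⁻ : ∀ {x y} → x ≤ y → ∀ a → a ⊢ x → a ⊢ y
  ≤⁻ {x} {y} x≤y a p = proj₂ (⊢⊓⁻ a x y (≡.trans (≡.sym (agree x≤y a)) p))

  conj≤⁺ : ∀ a {x} → a ⊢ x → conj a ≤ x
  conj≤⁺ a {x} ax = ≤⁺ λ b b⊢ → ⊢-mono (⊢conj⁻ {a = a} b⊢) x ax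

  conj≤⁻ : ∀ a {x} → conj a ≤ x → a ⊢ x
  conj≤⁻ a {x} c≤x = ≤⁻ c≤x a (⊢conj⁺ {a = a} λ _ → id)

  conj-ji : ∀ a → JoinIrreducible (conj a)
  conj-ji a = (λ c≈0 → contradiction (≡.trans (≡.sym (⊢conj⁺ {a = a} λ _ → id)) (agree c≈0 a)) λ ()) ,
    λ x y x⊔y≈c → Sum.map
      (λ ax → antisym (≤-trans (x≤x∨y x y) (≤-reflexive x⊔y≈c)) (conj≤⁺ a ax))
      (λ ay → antisym (≤-trans (y≤x∨y x y) (≤-reflexive x⊔y≈c)) (conj≤⁺ a ay))
      (⊢⊔⁻ a x y (≡.trans (agree x⊔y≈c a) (⊢conj⁺ {a = a} λ _ → id)))

  ji⇒conj : ∀ {x} → JoinIrreducible x → ∃[ a ] x ≈ conj a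
  ji⇒conj {x} ji =
    let c , c∈map , x≤c = find (⋁-prime ji (map conj (models x)) (≤-reflexive (pointwise (eval-dnf x))))
        a , a∈ , c≡ = ∈-map⁻ conj c∈map
        ax = proj₂ (∈-filter⁻ (⊢? x) {xs = proj₁ (valuations n)} a∈)
    in a , antisym (≡.subst (x ≤_) c≡ x≤c) (conj≤⁺ a ax)

  ji-≥ : ∀ {x y} → JoinIrreducible x → (∀ i → x ≤ var i → y ≤ var i) → y ≤ x
  ji-≥ {x} {y} ji h =
    let a , x≈conj = ji⇒conj ji
    in ≤⁺ λ b by → ≡.trans (agree x≈conj b) (⊢conj⁺ {a = a} λ i ai →
         ≤⁻ (h i (≤-trans (≤-reflexive x≈conj) (conj≤⁺ a ai))) b by)

  SameSide : J → J → Fin n → Set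
  SameSide (x , _) (y , _) i = (x ≤ var i → y ≤ var i) × (y ≤ var i → x ≤ var i)

  sameSide? : ∀ s t → U.Decidable (SameSide s t)
  sameSide? (x , _) (y , _) i =
    ((x ≤? var i) →-dec (y ≤? var i)) ×-dec ((y ≤? var i) →-dec (x ≤? var i))

  -- The one below the first distinguishing generator comes first: smaller elements lie below more
  -- generators, so the lattice order is extended.
  _⊏⁰_ : Rel J 0ℓ
  s ⊏⁰ t = ∃[ i ] (proj₁ s ≤ var i × ¬ (proj₁ t ≤ var i) × (∀ {i′} → i′ <ᶠ i → SameSide s t i′))

  ⊏⁰-trans : ∀ {s t u} → s ⊏⁰ t → t ⊏⁰ u → s ⊏⁰ u
  ⊏⁰-trans {s} {t} {u} (i , si , ¬ti , same) (j , tj , ¬uj , same′) with Fin.<-cmp i j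
  ... | tri< i<j _ _ = i , si , ¬ti ∘ proj₂ (same′ i<j) , λ k<i →
          let to , from = same k<i ; to′ , from′ = same′ (Fin.<-trans k<i i<j)
          in to′ ∘ to , from ∘ from′
  ... | tri≈ _ ≡.refl _ = contradiction tj ¬ti
  ... | tri> _ _ j<i = j , proj₂ (same j<i) tj , ¬uj , λ k<j →
          let to , from = same (Fin.<-trans k<j j<i) ; to′ , from′ = same′ k<j
          in to′ ∘ to , from ∘ from′

  ⊏⁰-irrefl : ∀ {s t} → proj₁ s ≈ proj₁ t → ¬ (s ⊏⁰ t)
  ⊏⁰-irrefl {s , _} {t , _} s≈t (i , si , ¬ti , _) =
    ¬ti (≤-trans (≈⇒≥ s≈t) si)

  ⊏⁰-total : ∀ s t → s ⊏⁰ t ⊎ proj₁ s ≈ proj₁ t ⊎ t ⊏⁰ s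
  ⊏⁰-total s@(x , xi) t@(y , yi) with least? (¬? ∘ sameSide? s t)
  ... | inj₁ none = inj₂ (inj₁ (antisym (ji-≥ yi (proj₂ ∘ same)) (ji-≥ xi (proj₁ ∘ same))))
    where
    same : ∀ i → SameSide s t i
    same i = decidable-stable (sameSide? s t i) (none i)
  ... | inj₂ (i , differ , before) = side (x ≤? var i) (y ≤? var i)
    where
    same : ∀ {i′} → i′ <ᶠ i → SameSide s t i′
    same i′<i = decidable-stable (sameSide? s t _) (before i′<i)

    side : Dec (x ≤ var i) → Dec (y ≤ var i) → s ⊏⁰ t ⊎ x ≈ y ⊎ t ⊏⁰ s
    side (yes p) (no ¬q) = inj₁ (i , p , ¬q , same)
    side (no ¬p) (yes q) = inj₂ (inj₂ (i , q , ¬p , λ i′<i → let to , from = same i′<i in from , to))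
    side (yes p) (yes q) = contradiction ((λ _ → q) , (λ _ → p)) differ
    side (no ¬p) (no ¬q) =
      contradiction ((λ p → contradiction p ¬p) , (λ q → contradiction q ¬q)) differ

  extension : IsLinearExtension _⊏⁰_
  extension = record
    { isStrictTotalOrder = record
      { isStrictPartialOrder = record
        { isEquivalence = On.isEquivalence proj₁ isEquivalence
        ; irrefl        = λ {s} {t} → ⊏⁰-irrefl {s} {t}
        ; trans         = λ {s} {t} {u} → ⊏⁰-trans {s} {t} {u}
        ; <-resp-≈      =
            (λ { {s , _} {t , _} {u , _} t≈u (i , si , ¬ti , same) → i , si ,
                 (λ ui → ¬ti (≤-trans (≤-reflexive t≈u) ui)) ,
                 λ {k} k<i → (λ sk → ≤-trans (≈⇒≥ t≈u) (proj₁ (same k<i) sk)) ,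
                             (λ uk → proj₂ (same k<i) (≤-trans (≤-reflexive t≈u) uk)) })
          , (λ { {s , _} {t , _} {u , _} t≈u (i , ti , ¬si , same) → i ,
                 ≤-trans (≈⇒≥ t≈u) ti , ¬si ,
                 λ {k} k<i → (λ uk → proj₁ (same k<i) (≤-trans (≤-reflexive t≈u) uk)) ,
                             (λ sk → ≤-trans (≈⇒≥ t≈u) (proj₂ (same k<i) sk)) })
        }
      ; compare = λ s t → compare s t (⊏⁰-total s t)
      }
    ; extends = λ {s} {t} → extends s t (⊏⁰-total s t)
    }
    where
    asym : ∀ s t → s ⊏⁰ t → ¬ (t ⊏⁰ s)
    asym s t s⊏t t⊏s = ⊏⁰-irrefl {s} {s} refl (⊏⁰-trans {s} {t} {s} s⊏t t⊏s)

    compare : ∀ s t → s ⊏⁰ t ⊎ proj₁ s ≈ proj₁ t ⊎ t ⊏⁰ s → Tri (s ⊏⁰ t) (proj₁ s ≈ proj₁ t) (t ⊏⁰ s)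
    compare s t (inj₁ s⊏t)        = tri< s⊏t (λ s≈t → ⊏⁰-irrefl {s} {t} s≈t s⊏t) (asym s t s⊏t)
    compare s t (inj₂ (inj₁ s≈t)) = tri≈ (⊏⁰-irrefl {s} {t} s≈t) s≈t (⊏⁰-irrefl {t} {s} (sym s≈t))
    compare s t (inj₂ (inj₂ t⊏s)) =
      tri> (asym t s t⊏s) (λ s≈t → ⊏⁰-irrefl {t} {s} (sym s≈t) t⊏s) t⊏s

    extends : ∀ s t → s ⊏⁰ t ⊎ proj₁ s ≈ proj₁ t ⊎ t ⊏⁰ s → proj₁ s < proj₁ t → s ⊏⁰ t
    extends s t (inj₁ s⊏t)        _             = s⊏t
    extends s t (inj₂ (inj₁ s≈t)) (_ , s≉t)     = contradiction s≈t s≉t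
    extends (x , _) (y , _) (inj₂ (inj₂ (i , yi , ¬xi , _))) (x≤y , _) =
      contradiction (≤-trans x≤y yi) ¬xi

freeNatural : ℕ → NaturallyOrderedLattice
freeNatural n = record
  { finiteDistributiveLattice = free n
  ; _⊏_       = FiniteDistributiveLattice.Antilex (free n) (FreeOrder._⊏⁰_ n)
  ; isNatural = FreeOrder._⊏⁰_ n , FreeOrder.extension n , λ _ _ → mk⇔ id id
  }

-- Kernels of homomorphisms from free lattices

module Kernel (K : OrderedLattice) (K-natural : Natural K)
              {n : ℕ} (v : Fin n → OrderedLattice.Carrier K) where
  private
    module K where
      open Lattice (OrderedLattice.finiteDistributiveLattice K) public
      open Natural K-natural public
      open AntilexProperties (OrderedLattice.finiteDistributiveLattice K) extension public
    module O⁰ = IsStrictTotalOrder (K.IsLinearExtension.isStrictTotalOrder K.extension)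
    module F = Lattice (free n)
    module N = FreeOrder n

  ⟦_⟧ : Term n → K.Carrier
  ⟦ var i ⟧ = v i
  ⟦ 𝟘 ⟧     = K.0#
  ⟦ 𝟙 ⟧     = K.1#
  ⟦ x ⊔ y ⟧ = ⟦ x ⟧ K.∨ ⟦ y ⟧
  ⟦ x ⊓ y ⟧ = ⟦ x ⟧ K.∧ ⟦ y ⟧

  -- The prime filter of the elements above p, as a valuation of the generators.
  above : K.Carrier → Vec Bool n
  above p = tabulate λ i → does (p K.≤? v i)

  above⁺ : ∀ {p} i → p K.≤ v i → above p ⊢ var i
  above⁺ {p} i p≤vi = ≡.trans (Vec.lookup∘tabulate _ i) (dec-true (p K.≤? v i) p≤vi)

  above⁻ : ∀ {p} i → above p ⊢ var i → p K.≤ v i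
  above⁻ {p} i h with p K.≤? v i | ≡.trans (≡.sym (Vec.lookup∘tabulate (λ i → does (p K.≤? v i)) i)) h
  ... | yes p≤vi | _ = p≤vi
  ... | no _     | ()

  ⊢⇒≤ : ∀ {p} x → above p ⊢ x → p K.≤ ⟦ x ⟧
  ⊢⇒≤ (var i) h = above⁻ i h
  ⊢⇒≤ 𝟙       h = K.maximum _
  ⊢⇒≤ {p} (x ⊔ y) h = [ (λ hx → K.≤-trans (⊢⇒≤ x hx) (K.x≤x∨y _ _))
                      , (λ hy → K.≤-trans (⊢⇒≤ y hy) (K.y≤x∨y _ _)) ] (⊢⊔⁻ (above p) x y h)
  ⊢⇒≤ {p} (x ⊓ y) h =
    let hx , hy = ⊢⊓⁻ (above p) x y h in K.∧-greatest (⊢⇒≤ x hx) (⊢⇒≤ y hy)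

  ≤⇒⊢ : ∀ {p} → K.JoinIrreducible p → ∀ x → p K.≤ ⟦ x ⟧ → above p ⊢ x
  ≤⇒⊢ pi (var i) h = above⁺ i h
  ≤⇒⊢ pi 𝟘       h = contradiction h (K.ji-≰0 pi)
  ≤⇒⊢ pi 𝟙       h = ≡.refl
  ≤⇒⊢ {p} pi (x ⊔ y) h = [ ⊢⊔⁺ˡ (above p) x y ∘ ≤⇒⊢ pi x
                         , ⊢⊔⁺ʳ (above p) x y ∘ ≤⇒⊢ pi y ] (K.ji-prime pi h)
  ≤⇒⊢ {p} pi (x ⊓ y) h = ⊢⊓⁺ (above p) x y (≤⇒⊢ pi x (K.≤-trans h (K.x∧y≤x _ _)))
                                           (≤⇒⊢ pi y (K.≤-trans h (K.x∧y≤y _ _)))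

  -- For a join-irreducible `j`, `j ≤ ⟦ x ⟧` amounts to `above j ⊢ x`. Evaluation in `K` is thus
  -- governed by Boolean valuations and respects equality of terms.
  ⟦⟧-mono : ∀ {x y} → x F.≤ y → ⟦ x ⟧ K.≤ ⟦ y ⟧
  ⟦⟧-mono {x} {y} x≤y = K.≤-by-ji λ ji j≤x → ⊢⇒≤ y (N.≤⁻ x≤y _ (≤⇒⊢ ji x j≤x))

  kernel : Congruence (free n)
  kernel = record
    { _~_              = K._≈_ on ⟦_⟧
    ; isDecEquivalence = record
      { isEquivalence = On.isEquivalence ⟦_⟧ K.isEquivalence
      ; _≟_           = λ x y → ⟦ x ⟧ K.≟ ⟦ y ⟧
      }
    ; ≈⇒~              = λ x≈y → K.antisym (⟦⟧-mono (F.≤-reflexive x≈y)) (⟦⟧-mono (F.≈⇒≥ x≈y))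
    ; ∨-cong~          = K.∨-cong
    ; ∧-cong~          = K.∧-cong
    }

  -- The lower adjoint of `⟦_⟧`: the meet of all generators with value above `p`.
  generators : K.J → F.J
  generators (p , _) = conj (above p) , N.conj-ji (above p)

  adjoint⁺ : ∀ (s : K.J) {z} → proj₁ s K.≤ ⟦ z ⟧ → conj (above (proj₁ s)) F.≤ z
  adjoint⁺ (p , pi) {z} h = N.conj≤⁺ (above p) (≤⇒⊢ pi z h)

  adjoint⁻ : ∀ (s : K.J) {z} → conj (above (proj₁ s)) F.≤ z → proj₁ s K.≤ ⟦ z ⟧
  adjoint⁻ (p , pi) {z} h = ⊢⇒≤ z (N.conj≤⁻ (above p) h)

  generators-cong : ∀ {s t : K.J} → proj₁ s K.≈ proj₁ t → conj (above (proj₁ s)) F.≈ conj (above (proj₁ t))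
  generators-cong {s} {t} s≈t = F.antisym
    (adjoint⁺ s (K.≤-trans (K.≤-reflexive s≈t) (adjoint⁻ t F.≤-refl)))
    (adjoint⁺ t (K.≤-trans (K.≈⇒≥ s≈t) (adjoint⁻ s F.≤-refl)))

  record RigidSurjection : Set where
    field
      hits    : ∀ y → ∃[ i ] v i K.≈ y
      ordered : ∀ {i y} → y K.⊏ v i → ∃[ i′ ] (i′ <ᶠ i × v i′ K.≈ y)

  module _ (rigid : RigidSurjection) where
    open RigidSurjection rigid

    -- Consider the first generator `i` that tells `p` from `q`. Were `v i` above `q` but not above
    -- `p`, then `p ⊏ v i`, and rigidity would make `p` the value of an earlier generator, which
    -- also tells them apart.
    generators-mono : ∀ {s t} → s K.⊏⁰ t → generators s N.⊏⁰ generators t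
    generators-mono {s@(p , pi)} {t@(q , qi)} s⊏t = go (least? (¬? ∘ same?))
      where
      Same : Fin n → Set
      Same i = (p K.≤ v i → q K.≤ v i) × (q K.≤ v i → p K.≤ v i)

      same? : U.Decidable Same
      same? i = ((p K.≤? v i) →-dec (q K.≤? v i)) ×-dec ((q K.≤? v i) →-dec (p K.≤? v i))

      q≰p : ¬ (q K.≤ p)
      q≰p q≤p with q K.≟ p
      ... | yes q≈p = O⁰.irrefl {s} {t} (K.sym q≈p) s⊏t
      ... | no q≉p  = O⁰.asym s⊏t (K.IsLinearExtension.extends K.extension (q≤p , q≉p))

      separates : ∀ {i} → v i K.≈ p → ¬ Same i
      separates vi≈p (to , _) = q≰p (K.≤-trans (to (K.≈⇒≥ vi≈p)) (K.≤-reflexive vi≈p))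

      -- Were `x ⊏ p`, the deciding join-irreducible `r ≤ p` would come before `q`; then `x` and `p`
      -- agree at `q`, and `q ≤ x` gives `q ≤ p`.
      p⊏ : ∀ {x} → q K.≤ x → ¬ (p K.≤ x) → p K.⊏ x
      p⊏ {x} q≤x p≰x with IsStrictTotalOrder.compare K.⊏-isStrictTotalOrder p x
      ... | tri< p⊏x _ _ = p⊏x
      ... | tri≈ _ p≈x _ = contradiction (K.≤-reflexive p≈x) p≰x
      ... | tri> _ _ x⊏p with K.⊏⁻ x⊏p
      ...   | u@(r , ri) , r≰x , r≤p , agree =
              contradiction (proj₁ (agree t u⊏t) q≤x) q≰p
        where
        u⊏t : u K.⊏⁰ t
        u⊏t with r K.≟ p
        ... | yes r≈p = proj₂ O⁰.<-resp-≈ {t} {s} {u} (K.sym r≈p) s⊏t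
        ... | no r≉p  = O⁰.trans (K.IsLinearExtension.extends K.extension (r≤p , r≉p)) s⊏t

      go : (∀ i → ¬ ¬ Same i) ⊎ ∃[ i ] (¬ Same i × (∀ {i′} → i′ <ᶠ i → ¬ ¬ Same i′)) →
           generators s N.⊏⁰ generators t
      go (inj₁ none) = let i , vi≈p = hits p in contradiction (separates vi≈p) (none i)
      go (inj₂ (i , differ , before)) with p K.≤? v i | q K.≤? v i
      ... | yes p≤ | yes q≤ = contradiction ((λ _ → q≤) , (λ _ → p≤)) differ
      ... | no p≰  | no q≰  =
        contradiction ((λ p≤ → contradiction p≤ p≰) , (λ q≤ → contradiction q≤ q≰)) differ
      ... | no p≰  | yes q≤ =
        let i′ , i′<i , vi′≈p = ordered (p⊏ q≤ p≰) in contradiction (separates vi′≈p) (before i′<i)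
      ... | yes p≤ | no q≰  = i , adjoint⁺ s p≤ , q≰ ∘ adjoint⁻ t , λ {i′} i′<i →
        let to , from = decidable-stable (same? i′) (before i′<i)
        in adjoint⁺ t ∘ to ∘ adjoint⁻ s , adjoint⁺ s ∘ from ∘ adjoint⁻ t

    open QuotientOrder (freeNatural n) kernel using (positiveCongruence; −N-⊑; least-cancel)
    open Congruence kernel using (_−N)
    open CongruenceProperties (free n) kernel using (−N-~; −N-least; −N-cong)
    open Transfer (free n) (OrderedLattice.finiteDistributiveLattice K) (FreeOrder.extension n) K.extension

    private
      module Nat = Natural (natural (freeNatural n))
      module A = AntilexProperties (free n) (FreeOrder.extension n)

    member : Setoid.Carrier (Con⁺ (freeNatural n) K)
    member = positiveCongruence , record
      { to                   = ⟦_⟧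
      ; isLatticeIsomorphism = record
        { isLatticeMonomorphism = record
          { isLatticeHomomorphism = record
            { isRelHomomorphism = record { cong = id }
            ; ∧-homo            = λ _ _ → K.refl
            ; ∨-homo            = λ _ _ → K.refl
            }
          ; injective = id
          }
        ; surjective = surjective
        }
      ; 0#-homo              = K.refl
      ; 1#-homo              = K.refl
      ; isOrderIsomorphism   = record
        { isOrderMonomorphism = record
          { isOrderHomomorphism = record
            { cong = id
            ; mono = λ {x} {y} x⊑y →
                K.⊑⁺ (Sum.map ⊏-reflect least-cancel (Nat.⊑⁻ (x⊑y {x} {y} K.refl K.refl)))
            }
          ; injective = id
          ; cancel    = λ {x} {y} x⊑y → −N-⊑ {x} {y} (Nat.⊑⁺ (Sum.map ⊏-transfer −N-cong (K.⊑⁻ x⊑y)))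
          }
        ; surjective = surjective
        }
      }
      where
      surjective : ∀ y → ∃[ x ] (∀ {z} → ⟦ z ⟧ K.≈ ⟦ x ⟧ → ⟦ z ⟧ K.≈ y)
      surjective y = let i , vi≈y = hits y in var i , λ z≈ → K.trans z≈ vi≈y

      ⊏-transfer : ∀ {x y} → ⟦ x ⟧ K.⊏ ⟦ y ⟧ → x −N A.⊏ y −N
      ⊏-transfer = transfer ⟦_⟧ (λ _ _ → K.refl) generators adjoint⁺ adjoint⁻
        generators-mono (λ {s} {t} → generators-cong {s} {t}) _−N −N-~ −N-least

      ⊏-reflect : ∀ {x y} → x −N A.⊏ y −N → ⟦ x ⟧ K.⊏ ⟦ y ⟧
      ⊏-reflect = reflect ⟦_⟧ (λ _ _ → K.refl) generators adjoint⁺ adjoint⁻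
        generators-mono (λ {s} {t} → generators-cong {s} {t}) _−N −N-~ −N-least

-- Rigid surjections from parameter words

module Enumeration {A : Set} {_≈_ _⊏_ : Rel A 0ℓ} (sto : IsStrictTotalOrder _≈_ _⊏_) where
  open IsStrictTotalOrder sto
  open IsStrictTotalOrder.Eq sto using () renaming (sym to ≈-sym; trans to ≈-trans)

  -- An element already present is dropped: `elements` may repeat itself, while the enumeration has
  -- to be strictly increasing.
  insert : A → List A → List A
  insert x []       = x ∷ []
  insert x (y ∷ ys) with compare x y
  ... | tri< _ _ _ = x ∷ y ∷ ys
  ... | tri≈ _ _ _ = y ∷ ys
  ... | tri> _ _ _ = y ∷ insert x ys

  insert-All : ∀ {P : Pred A 0ℓ} {x xs} → P x → All P xs → All P (insert x xs)
  insert-All                   px []         = px ∷ []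
  insert-All {x = x} {y ∷ ys} px (py ∷ pys) with compare x y
  ... | tri< _ _ _ = px ∷ py ∷ pys
  ... | tri≈ _ _ _ = py ∷ pys
  ... | tri> _ _ _ = py ∷ insert-All px pys

  insert-sorted : ∀ {x xs} → AllPairs _⊏_ xs → AllPairs _⊏_ (insert x xs)
  insert-sorted              []         = [] ∷ []
  insert-sorted {x} {y ∷ ys} (y⊏ ∷ ys⊏) with compare x y
  ... | tri< x⊏y _ _ = (x⊏y ∷ All.map (trans x⊏y) y⊏) ∷ y⊏ ∷ ys⊏
  ... | tri≈ _ _ _   = y⊏ ∷ ys⊏
  ... | tri> _ _ y⊏x = insert-All y⊏x y⊏ ∷ insert-sorted ys⊏

  insert-new : ∀ {x z} xs → z ≈ x → Any (z ≈_) (insert x xs)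
  insert-new         []       z≈x = here z≈x
  insert-new {x = x} (y ∷ ys) z≈x with compare x y
  ... | tri< _ _ _   = here z≈x
  ... | tri≈ _ x≈y _ = here (≈-trans z≈x x≈y)
  ... | tri> _ _ _   = there (insert-new ys z≈x)

  insert-old : ∀ {x z xs} → Any (z ≈_) xs → Any (z ≈_) (insert x xs)
  insert-old {x = x} {xs = y ∷ ys} z∈ with compare x y | z∈
  ... | tri< _ _ _ | _         = there z∈
  ... | tri≈ _ _ _ | _         = z∈
  ... | tri> _ _ _ | here z≈y  = here z≈y
  ... | tri> _ _ _ | there z∈′ = there (insert-old z∈′)

  sort : List A → List A
  sort []       = []
  sort (x ∷ xs) = insert x (sort xs)

  sort-sorted : ∀ xs → AllPairs _⊏_ (sort xs)
  sort-sorted []       = []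
  sort-sorted (x ∷ xs) = insert-sorted (sort-sorted xs)

  sort-complete : ∀ {z xs} → Any (z ≈_) xs → Any (z ≈_) (sort xs)
  sort-complete {xs = x ∷ xs} (here z≈x) = insert-new (sort xs) z≈x
  sort-complete               (there z∈) = insert-old (sort-complete z∈)

  lookup-mono : ∀ {xs} → AllPairs _⊏_ xs → ∀ {i j} → i <ᶠ j → lookup xs i ⊏ lookup xs j
  lookup-mono {x ∷ xs} (x⊏ ∷ _)  {zero}  {suc j} _   = All.lookup x⊏ (∈-lookup j)
  lookup-mono {x ∷ xs} (_ ∷ xs⊏) {suc i} {suc j} i<j = lookup-mono xs⊏ (s<s⁻¹ i<j)

  module Increasing {n} {f : Fin n → A} (f-mono : ∀ {i j} → i <ᶠ j → f i ⊏ f j) where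

    f-cancel : ∀ {i j} → f i ⊏ f j → i <ᶠ j
    f-cancel {i} {j} fi⊏fj with Fin.<-cmp i j
    ... | tri< i<j _ _      = i<j
    ... | tri≈ _ ≡.refl _   = contradiction fi⊏fj (irrefl Eq.refl)
    ... | tri> _ _ j<i      = contradiction fi⊏fj (asym (f-mono j<i))

    f-injective : ∀ {i j} → f i ≈ f j → i ≡ j
    f-injective {i} {j} fi≈fj with Fin.<-cmp i j
    ... | tri< i<j _ _ = contradiction (f-mono i<j) (irrefl fi≈fj)
    ... | tri≈ _ i≡j _ = i≡j
    ... | tri> _ _ j<i = contradiction (f-mono j<i) (irrefl (≈-sym fi≈fj))

module NaturalProperties {K : OrderedLattice} (K-natural : Natural K) where
  open Lattice (OrderedLattice.finiteDistributiveLattice K) public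
  open Natural K-natural public
  open AntilexProperties (OrderedLattice.finiteDistributiveLattice K) extension public

  ⊏-≤-trans : ∀ {x y z} → x ⊏ y → y ≤ z → x ⊏ z
  ⊏-≤-trans {x} {y} {z} x⊏y y≤z with IsStrictTotalOrder.compare ⊏-isStrictTotalOrder y z
  ... | tri< y⊏z _ _ = ⊏-trans x⊏y y⊏z
  ... | tri≈ _ y≈z _ = ⊏-respʳ y≈z x⊏y
  ... | tri> _ _ z⊏y = contradiction z⊏y (≤⇒⊏̸ y≤z)

  private
    module E = Enumeration ⊏-isStrictTotalOrder
    sorted = E.sort elements

    index-of : ∀ y → Any (y ≈_) sorted
    index-of y = E.sort-complete (complete y)

  -- The element `0#` makes the list nonempty; `suc l` matches the positive numbers of parameters in
  -- `dualRamsey`.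
  enumeration : Σ[ l ∈ ℕ ] Σ[ f ∈ (Fin (suc l) → Carrier) ]
                  ((∀ {i j} → i <ᶠ j → f i ⊏ f j) × (∀ y → ∃[ i ] f i ≈ y))
  enumeration = nonempty (lookup sorted) (E.lookup-mono (E.sort-sorted elements))
      (λ y → Any.index (index-of y) , sym (lookup-index (index-of y)))
    where
    nonempty : ∀ {l} (f : Fin l → Carrier) → (∀ {i j} → i <ᶠ j → f i ⊏ f j) → (∀ y → ∃[ i ] f i ≈ y) →
               Σ[ l ∈ ℕ ] Σ[ f ∈ (Fin (suc l) → Carrier) ]
                 ((∀ {i j} → i <ᶠ j → f i ⊏ f j) × (∀ y → ∃[ i ] f i ≈ y))
    nonempty {zero}  f f-mono f-hits with () ← proj₁ (f-hits 0#)
    nonempty {suc l} f f-mono f-hits = l , f , f-mono , f-hits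

  size : ℕ
  size = proj₁ enumeration

  enum : Fin (suc size) → Carrier
  enum = proj₁ (proj₂ enumeration)

  enum-mono : ∀ {i j} → i <ᶠ j → enum i ⊏ enum j
  enum-mono = proj₁ (proj₂ (proj₂ enumeration))

  enum-hits : ∀ y → ∃[ i ] enum i ≈ y
  enum-hits = proj₂ (proj₂ (proj₂ enumeration))

  open E.Increasing enum-mono public
    renaming (f-cancel to enum-cancel; f-injective to enum-injective)

noLetters : {X : Set} → Fin 0 → X
noLetters ()

module WordMember {K : OrderedLattice} (K-natural : Natural K) where
  open NaturalProperties K-natural

  values : ∀ {n} → Word 0 n (suc size) → Fin n → Carrier
  values w = at w noLetters enum

  values-rigid : ∀ {n} (w : Word 0 n (suc size)) → Kernel.RigidSurjection K K-natural (values w)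
  values-rigid w = record { hits = hits ; ordered = ordered }
    where
    module O = IsStrictTotalOrder ⊏-isStrictTotalOrder

    hits : ∀ y → ∃[ i ] values w i ≈ y
    hits y = let b , fb≈y = enum-hits y in
      first w b , trans (reflexive (at-first w noLetters enum b)) fb≈y

    ordered : ∀ {i y} → y ⊏ values w i → ∃[ i′ ] (i′ <ᶠ i × values w i′ ≈ y)
    ordered {i} {y} y⊏vi with at-image w noLetters enum i
    ... | inj₂ (b , vi≡fb , earlier) =
      let b′ , fb′≈y = enum-hits y
          fb′⊏fb = ⊏-respʳ (reflexive vi≡fb) (⊏-respˡ (sym fb′≈y) y⊏vi)
      in first w b′ , earlier (enum-cancel fb′⊏fb) ,
         trans (reflexive (at-first w noLetters enum b′)) fb′≈y

  wordMember : ∀ {n} → Word 0 n (suc size) → Setoid.Carrier (Con⁺ (freeNatural n) K)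
  wordMember w = Kernel.member K K-natural (values w) (values-rigid w)

module Member {M : NaturallyOrderedLattice} {K : OrderedLattice} (K-natural : Natural K)
              (Θ : PositiveCongruence M) (iso : M / Θ ≅ K) where
  private
    module M = NaturalProperties (natural M)
    module K = NaturalProperties K-natural
  open _≅_ iso using (to; isLatticeIsomorphism; isOrderIsomorphism)
  open IsLatticeIsomorphism isLatticeIsomorphism using (⟦⟧-cong; injective)
  open IsOrderIsomorphism isOrderIsomorphism using (mono; cancel)
  open PositiveCongruence Θ using (congruence; _−N)
  open QuotientOrder M congruence using (−N-⊑; least-cancel)
  open CongruenceProperties (NaturallyOrderedLattice.finiteDistributiveLattice M) congruence
    using (~-refl; −N-cong)

  least-⊏ : ∀ {x y} → to x K.⊏ to y → x −N M.⊏ y −N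
  least-⊏ {x} {y} gx⊏gy =
    [ id , (λ mx≈my → contradiction gx⊏gy (K.⊏-irrefl (⟦⟧-cong (least-cancel {x} {y} mx≈my)))) ]
      (M.⊑⁻ (cancel {x} {y} (K.⊑⁺ (inj₁ gx⊏gy)) {x} {y} ~-refl ~-refl))

  ⊏-least : ∀ {x y} → x −N M.⊏ y −N → to x K.⊏ to y
  ⊏-least {x} {y} mx⊏my =
    [ id , (λ gx≈gy → contradiction mx⊏my (M.⊏-irrefl (−N-cong {x} {y} (injective gx≈gy)))) ]
      (K.⊑⁻ (mono {x} {y} λ {a} {b} → −N-⊑ {x} {y} (M.⊑⁺ (inj₁ mx⊏my)) {a} {b}))

-- Congruences that contain the kernel of a word

module Factor {L K : OrderedLattice} (L-natural : Natural L) (K-natural : Natural K) where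
  private
    module L = NaturalProperties L-natural
    module K = NaturalProperties K-natural
    module WL = WordMember L-natural
    module WK = WordMember K-natural

  module _ {n} (w : Word 0 n (suc L.size))
           (Θ : PositiveCongruence (freeNatural n)) (iso : freeNatural n / Θ ≅ K)
           (Ψ⊆Θ : proj₁ (WL.wordMember w) ⊆ Θ) where
    private
      module F = NaturalProperties (natural (freeNatural n))
      module Ψ where
        open PositiveCongruence (proj₁ (WL.wordMember w)) public
        open CongruenceProperties (free n) congruence public
        open Member L-natural (proj₁ (WL.wordMember w)) (proj₂ (WL.wordMember w)) public
      module Θ where
        open PositiveCongruence Θ public
        open CongruenceProperties (free n) congruence public
        open Member K-natural Θ iso public
    open _≅_ iso
    open IsLatticeIsomorphism isLatticeIsomorphism using (⟦⟧-cong; injective; surjective; ∧-homo; ∨-homo)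
    open Kernel L L-natural (WL.values w) using (⟦_⟧)

    lift-ψ : ∀ {x y} → ⟦ x ⟧ L.≈ ⟦ y ⟧ → to x K.≈ to y
    lift-ψ {x} {y} e = ⟦⟧-cong (Ψ⊆Θ {x} {y} e)

    generator : Fin (suc L.size) → Term n
    generator b = var (first w b)

    ⟦generator⟧ : ∀ b → ⟦ generator b ⟧ L.≈ L.enum b
    ⟦generator⟧ b = L.reflexive (at-first w noLetters L.enum b)

    -- The map `ρ` on the enumerated elements of `L`. By `lift-ψ` any other generator with the same
    -- value in `L` would give the same element of `K`.
    image : Fin (suc L.size) → K.Carrier
    image = to ∘ generator

    locate : ∀ z → ∃[ b ] (L.enum b L.≈ ⟦ z ⟧ × image b K.≈ to z)
    locate z = let b , fb≈z = L.enum-hits ⟦ z ⟧ in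
      b , fb≈z , lift-ψ {generator b} {z} (L.trans (⟦generator⟧ b) fb≈z)

    preimage : ∀ y → ∃[ z ] to z K.≈ y
    preimage y = let z , eq = surjective y in z , eq {z} (Θ.~-refl {z})

    -- The least element z of a Θ-class is also least in its Ψ-class.
    image-ordered : ∀ {z i} → to z K.⊏ image i → ∃[ i′ ] (i′ <ᶠ i × image i′ K.≈ to z)
    image-ordered {z} {i} gz⊏ =
      let i′ , fi′≈ , im≈ = locate (z Θ.−N)
          x = generator i
          -- As `Ψ ⊆ Θ`, the least element of the Θ-class of `x` lies below that of its Ψ-class, so
          -- the comparison passes from the former to the latter.
          z⊏x : (z Θ.−N) F.⊏ (x Ψ.−N)
          z⊏x = F.⊏-≤-trans {z Θ.−N} {x Θ.−N} {x Ψ.−N}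
            (Θ.least-⊏ {z} {x} gz⊏) (Θ.−N-least {x} (Ψ⊆Θ {x Ψ.−N} {x} (Ψ.−N-~ x)))
          m≈z : ((z Θ.−N) Ψ.−N) F.≈ (z Θ.−N)
          m≈z = F.antisym (Ψ.−N≤ {z Θ.−N})
            (Θ.−N-least {z} (Θ.~-trans (Ψ⊆Θ {(z Θ.−N) Ψ.−N} {z Θ.−N} (Ψ.−N-~ (z Θ.−N))) (Θ.−N-~ z)))
          z⊏ : ⟦ z Θ.−N ⟧ L.⊏ ⟦ x ⟧
          z⊏ = Ψ.⊏-least {z Θ.−N} {x} (F.⊏-respˡ {x Ψ.−N} (F.sym m≈z) z⊏x)
      in i′ , L.enum-cancel (L.⊏-respˡ (L.sym fi′≈) (L.⊏-respʳ (⟦generator⟧ i) z⊏)) ,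
         K.trans im≈ (⟦⟧-cong (Θ.−N-~ z))

    imageWord : Σ[ x ∈ Word 0 (suc L.size) (suc K.size) ] (∀ b → WK.values x b K.≈ image b)
    imageWord = toWord K.setoid noLetters K.enum image (λ ()) K.enum-injective
      (λ i → inj₂ (K.enum-hits (image i)))
      (λ b → let z , gz≈ = preimage (K.enum b) ; i , _ , im≈ = locate z in i , K.trans im≈ gz≈)
      (λ {i} {b} {b′} fb≈ b′<b →
         let z , gz≈ = preimage (K.enum b′)
             i′ , i′<i , im≈ = image-ordered {z} {i}
               (K.⊏-respʳ fb≈ (K.⊏-respˡ (K.sym gz≈) (K.enum-mono b′<b)))
         in i′ , i′<i , K.trans im≈ gz≈)

    open Kernel K K-natural (WK.values (w · proj₁ imageWord)) using () renaming (⟦_⟧ to ⟦_⟧ᴷ)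

    generator-image : ∀ i → WK.values (w · proj₁ imageWord) i K.≈ to (var i)
    generator-image i = K.trans
      (K.reflexive (at-sub id w (proj₁ imageWord) noLetters K.enum i))
      -- The relation is the graph of `ρ`: every term with value `x` in `L` is sent to `y` in `K`.
      -- It holds at each parameter, hence at each letter of `w`.
      (K.sym (at-parametric (λ x y → ∀ z → ⟦ z ⟧ L.≈ x → to z K.≈ y) w (λ ())
        (λ b z z≈ → K.trans (lift-ψ {z} {generator b} (L.trans z≈ (L.sym (⟦generator⟧ b))))
                      (K.sym (proj₂ imageWord b)))
        i (var i) L.refl))

    to-unique : ∀ z → ⟦ z ⟧ᴷ K.≈ to z
    to-unique (var i) = generator-image i
    to-unique 𝟘       = K.sym 0#-homo
    to-unique 𝟙       = K.sym 1#-homo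
    to-unique (x ⊔ y) = K.trans (K.∨-cong (to-unique x) (to-unique y)) (K.sym (∨-homo x y))
    to-unique (x ⊓ y) = K.trans (K.∧-cong (to-unique x) (to-unique y)) (K.sym (∧-homo x y))

    factor : Setoid._≈_ (Con⁺ (freeNatural n) K) (Θ , iso) (WK.wordMember (w · proj₁ imageWord))
    factor =
      (λ {x} {y} x~y → K.trans (to-unique x) (K.trans (⟦⟧-cong x~y) (K.sym (to-unique y)))) ,
      (λ {x} {y} e → injective (K.trans (K.sym (to-unique x)) (K.trans e (to-unique y))))

-- From dual Ramsey to congruences

open import Data.Nat.Base using (_≤_)

theorem3p12 : (L : NaturallyOrderedLattice) (Φ : PositiveCongruence L) (k : ℕ) → 2 ≤ k →
    Σ[ N ∈ NaturallyOrderedLattice ]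
    ((χ : Coloring k (Con⁺ N (L / Φ))) →
    Σ[ Ψ ∈ Setoid.Carrier (Con⁺ N (NaturallyOrderedLattice.orderedLattice L)) ]
    Monochromatic χ (λ Θ → proj₁ Ψ ⊆ proj₁ Θ))
theorem3p12 L Φ (suc k) _ = freeNatural len , monochromatic
  where
  L-natural : Natural (NaturallyOrderedLattice.orderedLattice L)
  L-natural = natural L

  K-natural : Natural (L / Φ)
  K-natural = QuotientOrder.quotientNatural L (PositiveCongruence.congruence Φ)

  module L = WordMember L-natural
  module K = WordMember K-natural

  ramsey = dualRamsey (NaturalProperties.size L-natural) (NaturalProperties.size K-natural) k
  len = proj₁ ramsey

  monochromatic : (χ : Coloring (suc k) (Con⁺ (freeNatural len) (L / Φ))) →
    Σ[ Ψ ∈ Setoid.Carrier (Con⁺ (freeNatural len) (NaturallyOrderedLattice.orderedLattice L)) ]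
    Monochromatic χ (λ Θ → proj₁ Ψ ⊆ proj₁ Θ)
  monochromatic χ =
    let w , c , mono = proj₂ ramsey (λ x → Func.to χ (K.wordMember x))
    in L.wordMember w , c , λ (Θ , iso) Ψ⊆Θ →
         -- `Θ` and the kernel of the composed word carry different isomorphisms but relate the same
         -- pairs, so they have the same color.
         ≡.trans (Func.cong χ (Factor.factor L-natural K-natural w Θ iso Ψ⊆Θ))
                 (mono (proj₁ (Factor.imageWord L-natural K-natural w Θ iso Ψ⊆Θ)))
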